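{- Let $t \ge 4$ be an integer and let $G$ be a $t$-tough graph on $n \ge 3$ vertices with (non-decreasing) degree sequence $d_1, d_2, \dots, d_n$. Suppose that for all positive integers $i < \frac{n}{2}$, $d_i \le i$ implies $d_{n-i+t} \ge n-i$. Then $G$ is pancyclic.
   Context: Graphs are simple, undirected and finite. A non-decreasing sequence $d_1 \le d_2 \le \dots \le d_n$ is a degree sequence of a graph $G$ if the vertices of $G$ can be labeled $v_1, \dots, v_n$ such that $\deg(v_i) = d_i$ for all $i$. Let $c(H)$ denote the number of components of a graph $H$. For a real number $t \ge 0$, $G$ is $t$-tough if $|S| \ge t \cdot c(G-S)$ for all $S \subseteq V(G)$ with $c(G-S) \ge 2$ (so complete graphs are $t$-tough for every $t$). A graph $G$ is pancyclic if it contains cycles of every length from $3$ to $|V(G)|$. (For the $t$-tough graphs considered here, $d_i \le i$ with $i < n/2$ can only occur when $i \ge t$, so the index $n-i+t$ is at most $n$ whenever it is used.) -}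

module Defs where

open import Data.Fin.Base as Fin using (Fin; toℕ)
open import Data.Fin.Permutation using (Permutation′; _⟨$⟩ʳ_)
open import Data.Fin.Subset using (Subset; ∣_∣; _∉_)
open import Data.Nat.Base using (ℕ; suc; _≤_; _*_)
open import Data.Product.Base using (Σ; _×_)
open import Data.Refinement.Base using (Refinement-syntax; value)
open import Data.Vec.Base using (allFin; count)
open import Function.Base using (_on_)
open import Function.Bundles using (_⇔_)
open import Function.Definitions using (Injective; StrictlySurjective)
open import Level using (0ℓ)
open import Relation.Binary.Construct.Closure.ReflexiveTransitive using (Star)
open import Relation.Binary.Core using (Rel)
open import Relation.Binary.Definitions using (Decidable; Irreflexive; Monotonic₁; Symmetric)
open import Relation.Binary.PropositionalEquality.Core using (_≡_; cong)

record Graph (V : Set) : Set₁ where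
  field
    Adj    : Rel V 0ℓ
    sym    : Symmetric Adj
    irrefl : Irreflexive _≡_ Adj
    Adj?   : Decidable Adj

open Graph public using (Adj; Adj?)

degree : ∀ {n} → Graph (Fin n) → Fin n → ℕ
degree {n} G v = count (Adj? G v) (allFin n)

-- Sequences d₁, …, dₙ are functions on Fin n; the element k of Fin n
-- stands for the one-based index toℕ k + 1.
index : ∀ {n} → Fin n → ℕ
index k = suc (toℕ k)

IsDegreeSequence : ∀ {n} → Graph (Fin n) → (Fin n → ℕ) → Set
IsDegreeSequence {n} G d =
  Monotonic₁ Fin._≤_ _≤_ d ×
  Σ (Permutation′ n) λ v → ∀ i → degree G (v ⟨$⟩ʳ i) ≡ d i

-- Membership proofs in the refinement type are irrelevant, so each
-- vertex outside S occurs exactly once in G − S.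
infixl 6 _−_
_−_ : ∀ {n} → Graph (Fin n) → (S : Subset n) → Graph [ v ∈ Fin n ∣ v ∉ S ]
G − S = record
  { Adj    = Adj G on value
  ; sym    = Graph.sym G
  ; irrefl = λ u≡v → Graph.irrefl G (cong value u≡v)
  ; Adj?   = λ u v → Adj? G (value u) (value v)
  }

Connected : ∀ {V} → Graph V → Rel V 0ℓ
Connected G = Star (Adj G)

-- c(H) = k: the connectedness classes of H are labelled bijectively by Fin k.
HasComponents : ∀ {V} → Graph V → ℕ → Set
HasComponents {V} H k =
  Σ (V → Fin k) λ f →
    StrictlySurjective _≡_ f × (∀ u v → Connected H u v ⇔ f u ≡ f v)

Tough : ∀ {n} → ℕ → Graph (Fin n) → Set
Tough {n} t G =
  ∀ (S : Subset n) k → HasComponents (G − S) k → 2 ≤ k → t * k ≤ ∣ S ∣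

record Cycle {V : Set} (G : Graph V) (ℓ : ℕ) : Set where
  field
    3≤ℓ       : 3 ≤ ℓ
    vertex    : Fin ℓ → V
    injective : Injective _≡_ _≡_ vertex
    step      : ∀ i j → toℕ j ≡ suc (toℕ i) → Adj G (vertex i) (vertex j)
    close     : ∀ i j → toℕ i ≡ 0 → suc (toℕ j) ≡ ℓ → Adj G (vertex j) (vertex i)

Pancyclic : ∀ {n} → Graph (Fin n) → Set
Pancyclic {n} G = ∀ ℓ → 3 ≤ ℓ → ℓ ≤ n → Cycle G ℓ

{-# OPTIONS --safe #-}
module Submission where

-- Fix a vertex h with 2 deg h ≥ n. If G − h has a Hamiltonian cycle, then counting the
-- neighbours of h on it against their shift by r yields two of them at distance r, for
-- every r, hence cycles of all lengths.
--
-- For the cycle, add edges to G one by one: if the graph A so far is not complete, let y be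
-- a vertex of maximal degree among those with a non-neighbour and x a non-neighbour of y of
-- maximal degree. By induction A + xy − h is Hamiltonian, so A − h has a Hamiltonian cycle
-- or a Hamiltonian path from x to y. If deg x + deg y ≥ n − t + 2, a closure lemma in the
-- style of Bondy and Chvátal applies: at most t − 2 edges (v , w) of the path satisfy neither
-- x ~ w nor y ~ v. Call a vertex of the path central if its predecessor is adjacent to y and
-- its successor to x. If no rotation closes the path, then central vertices are isolated by
-- deleting few vertices, too few if there is a central vertex at all (it has degree ≥ 2t,
-- which forces at least t of them); and without central vertices at most 2t − 2 deleted
-- vertices separate x from y. If deg x + deg y < n − t + 2, the degree condition produces
-- so many vertices adjacent to everything that the non-neighbours of y or the predecessors
-- of these vertices on the path violate toughness.

open import Defs

open import Data.Bool.Base using (Bool; true; false; if_then_else_)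
open import Data.Empty using (⊥; ⊥-elim)
open import Data.Fin.Base as Fin using (Fin; toℕ)
open import Data.Fin.Permutation using (_⟨$⟩ʳ_; _⟨$⟩ˡ_; inverseˡ; inverseʳ)
import Data.Fin.Properties as Fin
open import Data.Fin.Subset as Subset using (Subset; ∣_∣; _∉_)
open import Data.Fin.Subset.Properties using (_∈?_)
open import Data.Irrelevant using ([_])
open import Data.List.Base using (List; []; _∷_; _++_; map; reverse; length; allFin; tabulate; cartesianProduct)
open import Data.List.Membership.Propositional using (_∈_)
open import Data.List.Membership.Propositional.Properties
  using (∈-allFin; ∈-map⁺; ∈-map⁻; ∈-∃++; ∈-++⁺ˡ; ∈-++⁺ʳ; ∈-cartesianProduct⁺)
open import Data.List.Membership.Propositional.Properties.WithK using (unique∧set⇒bag)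
import Data.List.Properties as List
open import Data.List.Relation.Binary.BagAndSetEquality using (∼bag⇒↭)
open import Data.List.Relation.Binary.Permutation.Propositional
  using (_↭_; ↭-sym; ↭-trans; ↭-refl; ↭-reflexive; prep; ↭⇒↭ₛ)
import Data.List.Relation.Binary.Permutation.Propositional.Properties as Perm
import Data.List.Relation.Binary.Permutation.Setoid.Properties as PermSetoid
open import Data.List.Relation.Unary.All as All using (All; []; _∷_)
open import Data.List.Relation.Unary.AllPairs using ([]; _∷_)
open import Data.List.Relation.Unary.Any as Any using (here; there)
import Data.List.Relation.Unary.Unique.DecSetoid as UniqueDec
open import Data.List.Relation.Unary.Unique.Propositional using (Unique)
import Data.List.Relation.Unary.Unique.Propositional.Properties as Unique
open import Data.Nat.Base using (ℕ; zero; suc; _+_; _*_; _∸_; _≤_; _<_; z≤n; s≤s)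
open import Data.Nat.ListAction using (sum)
open import Data.Nat.ListAction.Properties using (sum-↭; sum-++)
open import Data.Nat.Properties
open import Data.Nat.Tactic.RingSolver using (solve-∀)
open import Data.Product.Base using (Σ; ∃; _×_; _,_; proj₁; proj₂)
open import Data.Refinement.Base using (Refinement-syntax; _,_; value)
open import Data.Sum.Base using (_⊎_; inj₁; inj₂)
open import Data.Unit.Base using (⊤; tt)
import Data.Vec.Base as Vec
open import Data.Vec.Properties using (lookup⇒[]=; []=⇒lookup; lookup∘tabulate)
open import Function.Base using (_∘_; id; case_of_)
open import Function.Bundles using (mk⇔; Equivalence)
open import Level using (0ℓ)
open import Relation.Binary.Construct.Closure.ReflexiveTransitive as Star using (Star; ε; _◅_; _◅◅_)
open import Relation.Binary.Definitions using (Tri; tri<; tri≈; tri>)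
open import Relation.Binary.PropositionalEquality
open import Relation.Nullary using (Dec; yes; no; ¬_; does)
open import Relation.Nullary.Decidable using (_×-dec_; _⊎-dec_; ¬?; decidable-stable; dec-true; dec-false)
open import Relation.Nullary.Negation using (contradiction)
import Relation.Nullary.Recomputable as Recomputable
open import Relation.Unary using (Pred; Decidable)

-- Finite sums and cardinalities

-- The cycle is sought in G - h because its n - 1 positions then carry all of the at least n/2
-- neighbours of h, which makes the pigeonhole count strict for every shift r. The price is that h
-- joins the deleted sets of the closure lemma and that an end of a path may have one neighbour off
-- the path. The threshold n - t + 2 pays for both: it leaves at most t - 2 free edges and, without
-- central vertices, at most t - 1 positions whose predecessor is not adjacent to y and whose
-- successor is not adjacent to x. With h this makes at most 2t - 2 deleted vertices, short of the
-- 2t that toughness demands for two components. Adding edges is harmless because both hypotheses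
-- survive it: toughness, and the degree condition once it is read as a statement about numbers of
-- vertices. The choice of y and then x serves the case of a small degree sum: every vertex of
-- degree above deg y is adjacent to all others, and every non-neighbour of y has degree at most deg
-- x.

cancel-≤ : ∀ c {a b l r} → l ≤ r → c + a ≡ l → r ≡ c + b → a ≤ b
cancel-≤ c {a} {b} l≤r refl refl = +-cancelˡ-≤ c a b l≤r

≤⇒⊥ : ∀ k {l r} → l ≤ r → l ≡ suc k + r → ⊥
≤⇒⊥ k {r = r} l≤r refl = <-irrefl refl (≤-trans (s≤s (m≤n+m r k)) l≤r)

⟦_⟧ : ∀ {a} {P : Set a} → Dec P → ℕ
⟦ P? ⟧ = if does P? then 1 else 0

module _ {a} {P : Set a} where

  ⟦⟧≤ : ∀ (P? : Dec P) {m} → (P → 1 ≤ m) → ⟦ P? ⟧ ≤ m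
  ⟦⟧≤ (yes p) f = f p
  ⟦⟧≤ (no _)  f = z≤n

  ⟦⟧-yes : ∀ (P? : Dec P) → P → 1 ≤ ⟦ P? ⟧
  ⟦⟧-yes (yes _) _ = ≤-refl
  ⟦⟧-yes (no ¬p) p = contradiction p ¬p

  ⟦⟧≤1 : ∀ (P? : Dec P) → ⟦ P? ⟧ ≤ 1
  ⟦⟧≤1 P? = ⟦⟧≤ P? (λ _ → ≤-refl)

  ⟦⟧-no : ∀ (P? : Dec P) → ¬ P → ⟦ P? ⟧ ≡ 0
  ⟦⟧-no (yes p) ¬p = contradiction p ¬p
  ⟦⟧-no (no _)  _  = refl

  ⟦⟧-sound : ∀ (P? : Dec P) → 1 ≤ ⟦ P? ⟧ → P
  ⟦⟧-sound (yes p) _ = p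

⟦⟧-mono : ∀ {a b} {P : Set a} {Q : Set b} (P? : Dec P) (Q? : Dec Q) → (P → Q) → ⟦ P? ⟧ ≤ ⟦ Q? ⟧
⟦⟧-mono P? Q? f = ⟦⟧≤ P? (⟦⟧-yes Q? ∘ f)

⟦⟧-disjoint : ∀ {a b} {P : Set a} {Q : Set b} (P? : Dec P) (Q? : Dec Q) → ¬ (P × Q) → ⟦ P? ⟧ + ⟦ Q? ⟧ ≤ 1
⟦⟧-disjoint (yes p) (yes q) ¬pq = contradiction (p , q) ¬pq
⟦⟧-disjoint (yes p) (no _)  _ = ≤-refl
⟦⟧-disjoint (no _)  Q?      _ = ⟦⟧≤1 Q?

module _ {A : Set} where

  ∑ : List A → (A → ℕ) → ℕ
  ∑ xs f = sum (map f xs)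

  ∑-mono : ∀ xs {f g : A → ℕ} → (∀ {x} → x ∈ xs → f x ≤ g x) → ∑ xs f ≤ ∑ xs g
  ∑-mono []       f≤g = z≤n
  ∑-mono (x ∷ xs) f≤g = +-mono-≤ (f≤g (here refl)) (∑-mono xs (f≤g ∘ there))

  ∑-mono-< : ∀ xs {f g : A → ℕ} → (∀ x → f x ≤ g x) → ∀ {y} → y ∈ xs → f y < g y → ∑ xs f < ∑ xs g
  ∑-mono-< (x ∷ xs) f≤g (here refl) fy<gy = +-mono-<-≤ fy<gy (∑-mono xs (λ {x} _ → f≤g x))
  ∑-mono-< (x ∷ xs) f≤g (there y∈)  fy<gy = +-mono-≤-< (f≤g x) (∑-mono-< xs f≤g y∈ fy<gy)

  ∑-cong : ∀ xs {f g : A → ℕ} → (∀ {x} → x ∈ xs → f x ≡ g x) → ∑ xs f ≡ ∑ xs g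
  ∑-cong []       f≡g = refl
  ∑-cong (x ∷ xs) f≡g = cong₂ _+_ (f≡g (here refl)) (∑-cong xs (f≡g ∘ there))

  ∑-+ : ∀ xs (f g : A → ℕ) → ∑ xs (λ x → f x + g x) ≡ ∑ xs f + ∑ xs g
  ∑-+ []       f g = refl
  ∑-+ (x ∷ xs) f g = trans (cong (f x + g x +_) (∑-+ xs f g)) (lem (f x) (g x) (∑ xs f) (∑ xs g))
    where lem : ∀ a b c d → (a + b) + (c + d) ≡ (a + c) + (b + d)
          lem = solve-∀

  ∑-const : ∀ xs c → ∑ xs (λ _ → c) ≡ length xs * c
  ∑-const []       c = refl
  ∑-const (x ∷ xs) c = cong (c +_) (∑-const xs c)

  ∑-perm : ∀ {xs ys} (f : A → ℕ) → xs ↭ ys → ∑ xs f ≡ ∑ ys f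
  ∑-perm f p = sum-↭ (Perm.map⁺ f p)

  ∑-positive : ∀ xs (f : A → ℕ) → 1 ≤ ∑ xs f → ∃ λ x → x ∈ xs × 1 ≤ f x
  ∑-positive (x ∷ xs) f 1≤ with f x in eq
  ... | suc k = x , here refl , ≤-trans (s≤s z≤n) (≤-reflexive (sym eq))
  ... | zero  with y , y∈ , 1≤fy ← ∑-positive xs f 1≤ = y , there y∈ , 1≤fy

  ∑-∈ : ∀ {xs x} (f : A → ℕ) → x ∈ xs → f x ≤ ∑ xs f
  ∑-∈ {x ∷ xs} f (here refl) = m≤m+n (f x) _
  ∑-∈ {y ∷ xs} f (there x∈)  = ≤-trans (∑-∈ f x∈) (m≤n+m _ (f y))

  ∑-none : ∀ xs {P : Pred A 0ℓ} (P? : Decidable P) → (∀ {x} → x ∈ xs → ¬ P x) → ∑ xs (⟦_⟧ ∘ P?) ≡ 0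
  ∑-none []       P? ¬P = refl
  ∑-none (x ∷ xs) P? ¬P = cong₂ _+_ (⟦⟧-no (P? x) (¬P (here refl))) (∑-none xs P? (¬P ∘ there))

  ∑-atMostOne : ∀ {xs} {P : Pred A 0ℓ} (P? : Decidable P) → Unique xs →
                (∀ {x y} → P x → P y → x ≡ y) → ∑ xs (⟦_⟧ ∘ P?) ≤ 1
  ∑-atMostOne P? [] uniq = z≤n
  ∑-atMostOne {x ∷ xs} P? (x∉ ∷ xs!) uniq with P? x
  ... | yes px = ≤-reflexive (cong suc (∑-none xs P? λ y∈ py → All.lookup x∉ y∈ (uniq px py)))
  ... | no  _  = ∑-atMostOne P? xs! uniq

∑-swap : ∀ {A B : Set} (xs : List A) (ys : List B) (f : A → B → ℕ) →
         ∑ xs (λ x → ∑ ys (f x)) ≡ ∑ ys (λ y → ∑ xs (λ x → f x y))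
∑-swap []       ys f = sym (trans (∑-const ys 0) (*-zeroʳ (length ys)))
∑-swap (x ∷ xs) ys f = trans (cong (∑ ys (f x) +_) (∑-swap xs ys f)) (sym (∑-+ ys (f x) _))

∑-map : ∀ {A B : Set} (h : A → B) xs (f : B → ℕ) → ∑ (map h xs) f ≡ ∑ xs (f ∘ h)
∑-map h xs f = cong sum (sym (List.map-∘ xs))

infix 8 #_
#_ : ∀ {n} {P : Pred (Fin n) 0ℓ} → Decidable P → ℕ
#_ {n} P? = ∑ (allFin n) (⟦_⟧ ∘ P?)

count-tabulate : ∀ {a} {A : Set a} {P : Pred A 0ℓ} (P? : Decidable P) {n} (f : Fin n → A) →
                 Vec.count P? (Vec.tabulate f) ≡ sum (tabulate (⟦_⟧ ∘ P? ∘ f))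
count-tabulate P? {zero}  f = refl
count-tabulate P? {suc n} f with P? (f Fin.zero)
... | yes _ = cong suc (count-tabulate P? (f ∘ Fin.suc))
... | no  _ = count-tabulate P? (f ∘ Fin.suc)

∑-allFin : ∀ {n} (f : Fin n → ℕ) → ∑ (allFin n) f ≡ sum (tabulate f)
∑-allFin f = cong sum (List.map-tabulate id f)

module _ {n : ℕ} where

  #-full : ∀ {P : Pred (Fin n) 0ℓ} (P? : Decidable P) → (∀ u → P u) → # P? ≡ n
  #-full P? all = trans (∑-cong (allFin n) {g = λ _ → 1} (λ {u} _ → ≤-antisym (⟦⟧≤1 (P? u)) (⟦⟧-yes (P? u) (all u))))
    (trans (∑-const (allFin n) 1) (trans (*-identityʳ _) (List.length-tabulate id)))

  #≤n : ∀ {P : Pred (Fin n) 0ℓ} (P? : Decidable P) → # P? ≤ n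
  #≤n P? = ≤-trans (∑-mono (allFin n) {g = λ _ → 1} (λ {u} _ → ⟦⟧≤1 (P? u)))
    (≤-reflexive (trans (∑-const (allFin n) 1) (trans (*-identityʳ _) (List.length-tabulate id))))

  #-mono : ∀ {P Q : Pred (Fin n) 0ℓ} (P? : Decidable P) (Q? : Decidable Q) → (∀ {u} → P u → Q u) → # P? ≤ # Q?
  #-mono P? Q? P⊆Q = ∑-mono (allFin n) (λ {u} _ → ⟦⟧-mono (P? u) (Q? u) P⊆Q)

  #-positive : ∀ {P : Pred (Fin n) 0ℓ} (P? : Decidable P) → 1 ≤ # P? → ∃ P
  #-positive P? 1≤ with u , _ , 1≤u ← ∑-positive (allFin n) _ 1≤ = u , ⟦⟧-sound (P? u) 1≤u

  #-∈ : ∀ {P : Pred (Fin n) 0ℓ} (P? : Decidable P) {u} → P u → 1 ≤ # P?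
  #-∈ P? {u} pu = ≤-trans (⟦⟧-yes (P? u) pu) (∑-∈ (⟦_⟧ ∘ P?) (∈-allFin u))

  #-≡ : ∀ w → # (λ (u : Fin n) → u Fin.≟ w) ≡ 1
  #-≡ w = ≤-antisym (∑-atMostOne (Fin._≟ w) (Unique.allFin⁺ n) (λ p q → trans p (sym q))) (#-∈ (Fin._≟ w) refl)

  #-⊎ : ∀ {P Q R : Pred (Fin n) 0ℓ} (P? : Decidable P) (Q? : Decidable Q) (R? : Decidable R) →
        (∀ {u} → R u → P u ⊎ Q u) → # R? ≤ # P? + # Q?
  #-⊎ P? Q? R? f = ≤-trans
    (∑-mono (allFin n) (λ {u} _ → ⟦⟧≤ (R? u) λ r → case f r of λ where
      (inj₁ p) → ≤-trans (⟦⟧-yes (P? u) p) (m≤m+n _ _)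
      (inj₂ q) → ≤-trans (⟦⟧-yes (Q? u) q) (m≤n+m _ _)))
    (≤-reflexive (∑-+ (allFin n) _ _))

  #-disjoint : ∀ {P Q R : Pred (Fin n) 0ℓ} (P? : Decidable P) (Q? : Decidable Q) (R? : Decidable R) →
        (∀ {u} → ¬ (P u × Q u)) → (∀ {u} → P u ⊎ Q u → R u) → # P? + # Q? ≤ # R?
  #-disjoint P? Q? R? dis f = ≤-trans (≤-reflexive (sym (∑-+ (allFin n) _ _)))
    (∑-mono (allFin n) λ {u} _ → case R? u of λ where
      (yes r) → ≤-trans (⟦⟧-disjoint (P? u) (Q? u) dis) (⟦⟧-yes (R? u) r)
      (no ¬r) → ≤-reflexive (sym (trans (⟦⟧-no (R? u) ¬r)
        (sym (cong₂ _+_ (⟦⟧-no (P? u) (λ p → ¬r (f (inj₁ p)))) (⟦⟧-no (Q? u) (λ q → ¬r (f (inj₂ q)))))))))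

  #-complement : ∀ {P : Pred (Fin n) 0ℓ} (P? : Decidable P) → # P? + # (λ u → ¬? (P? u)) ≡ n
  #-complement {P} P? = ≤-antisym
    (≤-trans (#-disjoint {P} {λ u → ¬ P u} {λ u → P u ⊎ ¬ P u} P? (λ u → ¬? (P? u)) all? (λ (p , ¬p) → ¬p p) (λ r → r)) (#≤n all?))
    (≤-trans (≤-reflexive (sym (#-full all? all))) (#-⊎ P? (λ u → ¬? (P? u)) all? (λ r → r)))
    where
    all? : Decidable (λ u → P u ⊎ ¬ P u)
    all? u = P? u ⊎-dec ¬? (P? u)
    all : ∀ u → P u ⊎ ¬ P u
    all u with P? u
    ... | yes p = inj₁ p
    ... | no ¬p = inj₂ ¬p

-- Counting the pairs related by E in both orders.
#-injection : ∀ {n k} {P : Pred (Fin n) 0ℓ} (P? : Decidable P) {Q : Pred (Fin k) 0ℓ} (Q? : Decidable Q)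
              {E : Fin n → Fin k → Set} (E? : ∀ u j → Dec (E u j)) →
              (∀ {u} → P u → ∃ λ j → Q j × E u j) →
              (∀ {u w j} → E u j → E w j → u ≡ w) → # P? ≤ # Q?
#-injection {n} {k} {P} P? {Q} Q? {E} E? tot inj = begin
  # P?                                             ≤⟨ ∑-mono (allFin n) (λ {u} _ → ⟦⟧≤ (P? u) (outer u)) ⟩
  ∑ (allFin n) (λ u → ∑ (allFin k) (⟦_⟧ ∘ QE? u))  ≡⟨ ∑-swap (allFin n) (allFin k) _ ⟩
  ∑ (allFin k) (λ j → # (λ u → QE? u j))           ≤⟨ ∑-mono (allFin k) (λ {j} _ → inner j) ⟩
  # Q?                                             ∎
  where
  open ≤-Reasoning
  QE? : ∀ u j → Dec (Q j × E u j)
  QE? u j = Q? j ×-dec E? u j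
  outer : ∀ u → P u → 1 ≤ ∑ (allFin k) (⟦_⟧ ∘ QE? u)
  outer u pu with j , qe ← tot pu = #-∈ (QE? u) {j} qe
  inner : ∀ j → # (λ u → QE? u j) ≤ ⟦ Q? j ⟧
  inner j with Q? j
  ... | yes q = ∑-atMostOne (λ u → yes q ×-dec E? u j) (Unique.allFin⁺ n) λ (_ , p) (_ , p′) → inj p p′
  ... | no ¬q = ≤-reflexive (∑-none (allFin n) (λ u → no ¬q ×-dec E? u j) λ _ (q , _) → ¬q q)

-- Toughness

deg : ∀ {n} → Graph (Fin n) → Fin n → ℕ
deg G u = # (Adj? G u)

degree≡deg : ∀ {n} (G : Graph (Fin n)) u → degree G u ≡ deg G u
degree≡deg G u = trans (count-tabulate (Adj? G u) id) (sym (∑-allFin (⟦_⟧ ∘ Adj? G u)))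

-- The elements of R lie in different components of G − S, as g is constant on each component
-- and fixes R; so toughness can be applied without determining the components.
ToughByLabels : ∀ {n} → ℕ → Graph (Fin n) → Set₁
ToughByLabels {n} t G =
  ∀ {S R : Pred (Fin n) 0ℓ} (S? : Decidable S) (R? : Decidable R) (g : Fin n → Fin n) →
  (∀ {u w} → ¬ S u → ¬ S w → Adj G u w → g u ≡ g w) →
  (∀ {u} → R u → ¬ S u × g u ≡ u) →
  2 ≤ # R? → t * # R? ≤ # S?

module _ {X : Set} (search : ∀ {P : Pred X 0ℓ} → Decidable P → Dec (∃ P)) where

  -- While some label is missed, it is punched out, which keeps the partition and shrinks the label
  -- set.
  surjectiveLabels : ∀ {m} (f : X → Fin m) →
    ∃ λ k → Σ (X → Fin k) λ g → (∀ j → ∃ λ u → g u ≡ j) × (∀ u w → f u ≡ f w → g u ≡ g w) × (∀ u w → g u ≡ g w → f u ≡ f w)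
  surjectiveLabels {zero}  f = 0 , f , (λ ()) , (λ _ _ p → p) , (λ _ _ p → p)
  surjectiveLabels {suc m} f with Fin.all? (λ j → search (λ u → f u Fin.≟ j))
  ... | yes hit = suc m , f , hit , (λ _ _ p → p) , (λ _ _ p → p)
  ... | no ¬hit with j , ¬j ← Fin.¬∀⟶∃¬ (suc m) _ (λ j → search (λ u → f u Fin.≟ j)) ¬hit
    with k , g , surj , to , from ← surjectiveLabels (λ u → Fin.punchOut {i = j} {j = f u} (λ eq → ¬j (u , sym eq)))
    = k , g , surj
    , (λ u w p → to u w (Fin.punchOut-cong j {i≢j = λ eq → ¬j (u , sym eq)} {i≢k = λ eq → ¬j (w , sym eq)} p))
    , (λ u w p → Fin.punchOut-injective (λ eq → ¬j (u , sym eq)) (λ eq → ¬j (w , sym eq)) (from u w p))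

module _ {n : ℕ} {E : Fin n → Fin n → Set} (E? : ∀ u w → Dec (E u w)) (E-sym : ∀ {u w} → E u w → E w u) where

  private
    Star-sym : ∀ {u w} → Star E u w → Star E w u
    Star-sym = Star.reverse E-sym

  -- Union–find.
  mergedLabels : ∀ (L : List (Fin n × Fin n)) → Σ (Fin n → Fin n) λ f →
    (∀ u w → f u ≡ f w → Star E u w) × (∀ u w → (u , w) ∈ L → E u w → f u ≡ f w)
  mergedLabels [] = id , (λ { _ _ refl → ε }) , (λ _ _ ())
  mergedLabels ((a , b) ∷ L) with f , sound , complete ← mergedLabels L | E? a b
  ... | no ¬e = f , sound , λ { _ _ (here refl) e → contradiction e ¬e ; u w (there p) e → complete u w p e }
  ... | yes e = f′ , sound′ , complete′
    where
    merge : Fin n → Fin n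
    merge j with j Fin.≟ f a
    ... | yes _ = f b
    ... | no _  = j
    f′ : Fin n → Fin n
    f′ u = merge (f u)
    sound′ : ∀ u w → f′ u ≡ f′ w → Star E u w
    sound′ u w eq with f u Fin.≟ f a | f w Fin.≟ f a
    ... | yes p | yes q = sound u w (trans p (sym q))
    ... | no _  | no _  = sound u w eq
    ... | yes p | no _  = sound u a p ◅◅ e ◅ sound b w eq
    ... | no _  | yes q = Star-sym (sound w a q ◅◅ e ◅ sound b u (sym eq))
    merge-ab : merge (f a) ≡ merge (f b)
    merge-ab with f a Fin.≟ f a | f b Fin.≟ f a
    ... | yes _ | yes _ = refl
    ... | yes _ | no _  = refl
    ... | no ¬p | _     = contradiction refl ¬p
    complete′ : ∀ u w → (u , w) ∈ (a , b) ∷ L → E u w → f′ u ≡ f′ w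
    complete′ _ _ (here refl) _  = merge-ab
    complete′ u w (there p)   e′ = cong merge (complete u w p e′)

module _ {n : ℕ} (G : Graph (Fin n)) (S : Subset n) where

  private
    V = [ v ∈ Fin n ∣ v ∉ S ]

    -- Membership proofs are irrelevant in the refinement type, but a negation can be recomputed.
    relevant : (v : V) → value v ∉ S
    relevant (v , [ v∉S ]) = Recomputable.¬-recompute v∉S

    search : ∀ {P : Pred V 0ℓ} → Decidable P → Dec (∃ P)
    search {P} P? with Fin.any? Q?
      where
      Q? : Decidable (λ u → Σ (u ∉ S) λ u∉S → P (u , [ u∉S ]))
      Q? u with u ∈? S
      ... | yes u∈S = no (λ (u∉S , _) → u∉S u∈S)
      ... | no u∉S  with P? (u , [ u∉S ])
      ...   | yes p = yes (u∉S , p)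
      ...   | no ¬p = no (λ (_ , p) → ¬p p)
    ... | yes (u , u∉S , p) = yes ((u , [ u∉S ]) , p)
    ... | no ¬p             = no λ (v , p) → ¬p (value v , relevant v , p)

    E : Fin n → Fin n → Set
    E u w = (u ∉ S × w ∉ S) × Adj G u w

    E? : ∀ u w → Dec (E u w)
    E? u w = (¬? (u ∈? S) ×-dec ¬? (w ∈? S)) ×-dec Adj? G u w

    connected : ∀ u w → Star E (value u) (value w) → Connected (G − S) u w
    connected u w ε = ε
    connected u w (_◅_ {j = x} ((_ , x∉S) , u~x) xs) = u~x ◅ connected (x , [ x∉S ]) w xs

  components : ∃ (HasComponents (G − S))
  components
    with f , sound , complete ← mergedLabels E? (λ ((p , q) , e) → (q , p) , Graph.sym G e) (cartesianProduct (allFin n) (allFin n))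
    with k , g , surj , to , from ← surjectiveLabels search (f ∘ value)
    = k , g , surj , λ u w → mk⇔
        (λ path → constant u w path)
        (λ eq → connected u w (sound _ _ (from u w eq)))
    where
    constant : ∀ u w → Connected (G − S) u w → g u ≡ g w
    constant u .u ε = refl
    constant u w (_◅_ {j = x} e path) = trans
      (to u x (complete (value u) (value x) (∈-cartesianProduct⁺ (∈-allFin _) (∈-allFin _)) ((relevant u , relevant x) , e)))
      (constant x w path)

  -- Two elements of R in one component have the same g-label, and g fixes both; hence R injects
  -- into the components.
  separated : ∀ {k} → HasComponents (G − S) k → (g : Fin n → Fin n) →
    (∀ {u w} → u ∉ S → w ∉ S → Adj G u w → g u ≡ g w) →
    ∀ {R : Pred (Fin n) 0ℓ} (R? : Decidable R) → (∀ {u} → R u → u ∉ S × g u ≡ u) → # R? ≤ k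
  separated {k} (f , surj , connects) g inv {R} R? fixed = ≤-trans
    (#-injection R? {λ _ → ⊤} (λ _ → yes tt) E′?
      (λ {u} r → f (u , [ proj₁ (fixed r) ]) , tt , (r , _ , refl , refl))
      (λ { {u} {w} (r , p , refl , eq) (r′ , p′ , refl , eq′) →
           trans (sym (proj₂ (fixed r))) (trans (g-const p p′ (Equivalence.from (connects p p′) (trans eq (sym eq′)))) (proj₂ (fixed r′))) }))
    (#≤n {k} (λ _ → yes tt))
    where
    E′ : Fin n → Fin k → Set
    E′ u j = R u × Σ V λ v → value v ≡ u × f v ≡ j
    E′? : ∀ u j → Dec (E′ u j)
    E′? u j = R? u ×-dec search (λ v → value v Fin.≟ u ×-dec f v Fin.≟ j)
    g-const : ∀ u w → Connected (G − S) u w → g (value u) ≡ g (value w)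
    g-const u .u ε = refl
    g-const u w (_◅_ {j = x} e path) = trans (inv (relevant u) (relevant x) e) (g-const x w path)

toughByLabels : ∀ {n t} {G : Graph (Fin n)} → Tough t G → ToughByLabels t G
toughByLabels {n} {t} {G} tough {S} S? R? g inv fixed 2≤R
  with k , comps ← components G (Vec.tabulate (does ∘ S?)) = begin
  t * # R?  ≤⟨ *-monoʳ-≤ t R≤k ⟩
  t * k     ≤⟨ tough σ k comps (≤-trans 2≤R R≤k) ⟩
  ∣ σ ∣     ≡⟨ trans (size (does ∘ S?)) (sym (∑-allFin (⟦_⟧ ∘ S?))) ⟩
  # S?      ∎
  where
  open ≤-Reasoning
  σ = Vec.tabulate (does ∘ S?)
  size : ∀ {m} (f : Fin m → Bool) → ∣ Vec.tabulate f ∣ ≡ sum (tabulate (λ u → if f u then 1 else 0))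
  size {zero}  f = refl
  size {suc m} f with f Fin.zero
  ... | true  = cong suc (size (f ∘ Fin.suc))
  ... | false = size (f ∘ Fin.suc)
  ∈σ : ∀ {u} → S u → u Subset.∈ σ
  ∈σ {u} s = lookup⇒[]= u σ (trans (lookup∘tabulate (does ∘ S?) u) (dec-true (S? u) s))
  ∈σ⁻ : ∀ {u} → u Subset.∈ σ → S u
  ∈σ⁻ {u} u∈ = decidable-stable (S? u) λ ¬s → case trans (sym (dec-false (S? u) ¬s)) (trans (sym (lookup∘tabulate (does ∘ S?) u)) ([]=⇒lookup u∈)) of λ ()
  R≤k : # R? ≤ k
  R≤k = separated G σ comps g (λ p q → inv (p ∘ ∈σ) (q ∘ ∈σ)) R? (λ r → (λ u∈ → proj₁ (fixed r) (∈σ⁻ u∈)) , proj₂ (fixed r))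

module ToughLemmas {n t : ℕ} {A : Graph (Fin n)} (tough : ToughByLabels t A) where

  -- As all neighbours of I lie in S, each vertex of I is a component of its own; z lies in a
  -- further one, which explains the successor. The labelling collapses everything outside I to z.
  isolated : ∀ {I S : Pred (Fin n) 0ℓ} (I? : Decidable I) (S? : Decidable S) {z} → ¬ I z → ¬ S z →
    (∀ {u} → I u → ¬ S u) → (∀ {u w} → I u → Adj A u w → S w) →
    1 ≤ # I? → t * suc (# I?) ≤ # S?
  isolated {I} {S} I? S? {z} z∉I z∉S I∩S N⊆S 1≤I = begin
    t * suc (# I?)    ≡⟨ cong (t *_) (trans (+-comm 1 _) (cong (# I? +_) (sym (#-≡ z)))) ⟩
    t * (# I? + # z?) ≤⟨ *-monoʳ-≤ t I+1≤R ⟩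
    t * # R?          ≤⟨ tough S? R? g inv fixed (≤-trans (+-mono-≤ 1≤I (≤-reflexive (sym (#-≡ z)))) I+1≤R) ⟩
    # S?              ∎
    where
    open ≤-Reasoning
    z? = λ u → u Fin.≟ z
    R? : Decidable (λ u → I u ⊎ u ≡ z)
    R? u = I? u ⊎-dec z? u
    I+1≤R : # I? + # z? ≤ # R?
    I+1≤R = #-disjoint I? z? R? (λ { (p , refl) → z∉I p }) (λ p → p)
    g : Fin n → Fin n
    g u with I? u
    ... | yes _ = u
    ... | no _  = z
    inv : ∀ {u w} → ¬ S u → ¬ S w → Adj A u w → g u ≡ g w
    inv {u} {w} u∉S w∉S u~w with I? u | I? w
    ... | yes p | _     = contradiction (N⊆S p u~w) w∉S
    ... | no _  | yes q = contradiction (N⊆S q (Graph.sym A u~w)) u∉S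
    ... | no _  | no _  = refl
    fixed : ∀ {u} → I u ⊎ u ≡ z → ¬ S u × g u ≡ u
    fixed {u} r with I? u
    fixed r        | yes p = I∩S p , refl
    fixed (inj₁ p) | no ¬p = contradiction p ¬p
    fixed (inj₂ refl) | no _ = z∉S , refl

  -- Deleting the neighbours of u isolates u and leaves w.
  2t≤deg : ∀ {u w} → u ≢ w → ¬ Adj A u w → t * 2 ≤ deg A u
  2t≤deg {u} {w} u≢w u≁w = subst (λ k → t * suc k ≤ deg A u) (#-≡ u)
    (isolated (λ v → v Fin.≟ u) (Adj? A u) (u≢w ∘ sym) u≁w
      (λ { refl → Graph.irrefl A refl }) (λ { refl u~ → u~ }) (≤-reflexive (sym (#-≡ u))))

toughByLabels-⊆ : ∀ {n t} {G A : Graph (Fin n)} → (∀ {u w} → Adj G u w → Adj A u w) → ToughByLabels t G → ToughByLabels t A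
toughByLabels-⊆ G⊆A tough S? R? g inv = tough S? R? g (λ p q e → inv p q (G⊆A e))

-- Rotations of Hamiltonian paths

range : ℕ → ℕ → List ℕ
range i zero    = []
range i (suc d) = i ∷ range (suc i) d

range-++ : ∀ i d e → range i (d + e) ≡ range i d ++ range (d + i) e
range-++ i zero    e = refl
range-++ i (suc d) e = cong (i ∷_) (trans (range-++ (suc i) d e) (cong (λ k → range (suc i) d ++ range k e) (+-suc d i)))

map-range : ∀ {A : Set} (f : ℕ → A) i d → map f (range (suc i) d) ≡ map (f ∘ suc) (range i d)
map-range f i zero    = refl
map-range f i (suc d) = cong (f (suc i) ∷_) (map-range f (suc i) d)

∈-range⁻ : ∀ {i d k} → k ∈ range i d → i ≤ k × k < i + d
∈-range⁻ {i} {suc d} (here refl) = ≤-refl , m<m+n i (s≤s z≤n)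
∈-range⁻ {i} {suc d} {k} (there k∈) with p , q ← ∈-range⁻ k∈ = <⇒≤ p , subst (k <_) (sym (+-suc i d)) q

∈-range⁺ : ∀ {i d k} → i ≤ k → k < i + d → k ∈ range i d
∈-range⁺ {i} {zero}  i≤k k<i = contradiction (≤-trans k<i (≤-trans (≤-reflexive (+-identityʳ i)) i≤k)) (<-irrefl refl)
∈-range⁺ {i} {suc d} {k} i≤k k<  with m≤n⇒m<n∨m≡n i≤k
... | inj₁ i<k  = there (∈-range⁺ i<k (subst (k <_) (+-suc i d) k<))
... | inj₂ refl = here refl

interval : ℕ → ℕ → List ℕ
interval i j = range i (j ∸ i)

interval-++ : ∀ {i j k} → i ≤ j → j ≤ k → interval i j ++ interval j k ≡ interval i k
interval-++ {i} i≤j j≤k with d , refl ← m≤n⇒∃[o]m+o≡n i≤j | e , refl ← m≤n⇒∃[o]m+o≡n j≤k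
  rewrite m+n∸m≡n i d | m+n∸m≡n (i + d) e | +-assoc i d e | m+n∸m≡n i (d + e) | +-comm i d = sym (range-++ i d e)

data Walk {n} (A : Graph (Fin n)) : Fin n → Fin n → List (Fin n) → Set where
  [_] : ∀ u → Walk A u u (u ∷ [])
  _∷_ : ∀ {u w z l} → Adj A u w → Walk A w z l → Walk A u z (u ∷ l)

-- A cycle through all vertices other than h; cycles of length one and two are not excluded.
record HamCycle {n} (A : Graph (Fin n)) (h : Fin n) : Set where
  field
    {first last} : Fin n
    {vertices}   : List (Fin n)
    walk         : Walk A first last vertices
    closing      : Adj A last first
    spanning     : h ∷ vertices ↭ allFin n

module _ {n} {A : Graph (Fin n)} where

  private
    sym-A = Graph.sym A

  _⟨_⟩ʷ_ : ∀ {a b c d l m} → Walk A a b l → Adj A b c → Walk A c d m → Walk A a d (l ++ m)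
  [ _ ]   ⟨ e ⟩ʷ q = e ∷ q
  (f ∷ p) ⟨ e ⟩ʷ q = f ∷ (p ⟨ e ⟩ʷ q)

  reverseʷ : ∀ {a b l} → Walk A a b l → Walk A b a (reverse l)
  reverseʷ [ u ] = [ u ]
  reverseʷ {l = u ∷ l} (e ∷ p) = subst (Walk A _ _) (sym (List.unfold-reverse u l)) (reverseʷ p ⟨ sym-A (head p e) ⟩ʷ [ u ])
    where
    head : ∀ {a b c l} → Walk A a b l → Adj A c a → Adj A c a
    head _ e = e

-- Only v 0, ..., v M matter; values beyond M are arbitrary. Using ℕ for positions lets shifts by
-- one be written without bounds.
record HamPath {n} (A : Graph (Fin n)) (h : Fin n) (M : ℕ) : Set where
  field
    v        : ℕ → Fin n
    path     : ∀ {i} → i < M → Adj A (v i) (v (suc i))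
    spanning : h ∷ map v (range 0 (suc M)) ↭ allFin n

module Rotations {n} {A : Graph (Fin n)} {h : Fin n} {M : ℕ} (P : HamPath A h M) where

  open HamPath P

  private
    sym-A = Graph.sym A

    -- Positions are recorded only up to order, so that a reversed segment keeps its ascending
    -- interval and a rotation spans because its intervals are a reordering of a partition of 0,
    -- ..., M.
    record Run (p q : ℕ) (is : List ℕ) : Set where
      field
        {list} : List (Fin n)
        walk   : Walk A (v p) (v q) list
        perm   : list ↭ map v is

    infixr 5 _⟨_⟩_
    _⟨_⟩_ : ∀ {p q p′ q′ is js} → Run p q is → Adj A (v q) (v p′) → Run p′ q′ js → Run p q′ (is ++ js)
    _⟨_⟩_ {is = is} {js} r e s = record
      { walk = Run.walk r ⟨ e ⟩ʷ Run.walk s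
      ; perm = ↭-trans (Perm.++⁺ (Run.perm r) (Run.perm s)) (↭-reflexive (sym (List.map-++ v is js))) }

    ascend : ∀ i d → i + d ≤ M → Walk A (v i) (v (i + d)) (map v (range i (suc d)))
    ascend i zero    _ = subst (λ k → Walk A (v i) (v k) (v i ∷ [])) (sym (+-identityʳ i)) [ v i ]
    ascend i (suc d) i+d<M = path (≤-trans (s≤s (m≤m+n i d)) (subst (_≤ M) (+-suc i d) i+d<M)) ∷
      subst (λ k → Walk A (v (suc i)) (v k) (map v (range (suc i) (suc d)))) (sym (+-suc i d))
        (ascend (suc i) d (subst (_≤ M) (+-suc i d) i+d<M))

    up : ∀ {i j} → i ≤ j → j ≤ M → Run i j (interval i (suc j))
    up {i} i≤j j≤M with d , refl ← m≤n⇒∃[o]m+o≡n i≤j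
      rewrite sym (+-suc i d) | m+n∸m≡n i (suc d) = record { walk = ascend i d j≤M ; perm = ↭-refl }

    down : ∀ {i j} → i ≤ j → j ≤ M → Run j i (interval i (suc j))
    down i≤j j≤M = record
      { walk = reverseʷ (Run.walk (up i≤j j≤M))
      ; perm = ↭-trans (Perm.↭-reverse _) (Run.perm (up i≤j j≤M)) }

    close : ∀ {p q is} → Run p q is → Adj A (v q) (v p) → is ↭ interval 0 (suc M) → HamCycle A h
    close r e perm = record
      { walk     = Run.walk r
      ; closing  = e
      ; spanning = ↭-trans (prep h (↭-trans (Run.perm r) (Perm.map⁺ v perm))) spanning }

    partition₂ : ∀ {a} → a ≤ suc M → interval 0 a ++ interval a (suc M) ≡ interval 0 (suc M)
    partition₂ = interval-++ z≤n

    partition₃ : ∀ {a b} → a ≤ b → b ≤ suc M →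
      interval 0 a ++ interval a b ++ interval b (suc M) ≡ interval 0 (suc M)
    partition₃ {a} a≤b b≤N = trans (cong (interval 0 a ++_) (interval-++ a≤b b≤N)) (partition₂ (≤-trans a≤b b≤N))

    partition₄ : ∀ {a b c} → a ≤ b → b ≤ c → c ≤ suc M →
      interval 0 a ++ interval a b ++ interval b c ++ interval c (suc M) ≡ interval 0 (suc M)
    partition₄ {a} {b} a≤b b≤c c≤N = trans
      (cong (λ l → interval 0 a ++ interval a b ++ l) (interval-++ b≤c c≤N)) (partition₃ a≤b (≤-trans b≤c c≤N))

    swap₃ : ∀ (A B C : List ℕ) {l} → A ++ B ++ C ≡ l → A ++ C ++ B ↭ l
    swap₃ A B C eq = ↭-trans (Perm.++⁺ˡ A (Perm.++-comm C B)) (↭-reflexive eq)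

    swapBC : ∀ (A B C D : List ℕ) {l} → A ++ B ++ C ++ D ≡ l → A ++ C ++ B ++ D ↭ l
    swapBC A B C D eq = ↭-trans (Perm.++⁺ˡ A (Perm.shifts C B)) (↭-reflexive eq)

    swapCD : ∀ (A B C D : List ℕ) {l} → A ++ B ++ C ++ D ≡ l → A ++ B ++ D ++ C ↭ l
    swapCD A B C D eq = ↭-trans (Perm.++⁺ˡ A (Perm.++⁺ˡ B (Perm.++-comm D C))) (↭-reflexive eq)

    rotateBCD : ∀ (A B C D : List ℕ) {l} → A ++ B ++ C ++ D ≡ l → A ++ D ++ B ++ C ↭ l
    rotateBCD A B C D eq = ↭-trans (Perm.++⁺ˡ A (↭-trans (Perm.++-comm D (B ++ C)) (↭-reflexive (List.++-assoc B C D)))) (↭-reflexive eq)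

  -- In the names below x = v 0 and y = v M are the ends of the path.
  x~_ y~_ : ℕ → Set
  x~ i = Adj A (v 0) (v i)
  y~ i = Adj A (v M) (v i)

  crossing : ∀ {i} → i < M → x~ suc i → y~ i → HamCycle A h
  crossing i<M xi yi = close
    (up z≤n (<⇒≤ i<M) ⟨ sym-A yi ⟩ down i<M ≤-refl) (sym-A xi)
    (↭-reflexive (partition₂ (s≤s (<⇒≤ i<M))))

  chord-inner : ∀ {p q} → p < q → q < M → Adj A (v p) (v (suc q)) → x~ suc p → y~ q → HamCycle A h
  chord-inner p<q q<M pq xp yq = close
    (down z≤n (≤-trans (<⇒≤ p<q) (<⇒≤ q<M)) ⟨ xp ⟩ up p<q (<⇒≤ q<M) ⟨ sym-A yq ⟩ down q<M ≤-refl) (sym-A pq)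
    (↭-reflexive (partition₃ (s≤s (<⇒≤ p<q)) (s≤s (<⇒≤ q<M))))

  chord-right : ∀ {p q} → p < q → q < M → Adj A (v p) (v q) → x~ suc q → y~ suc p → HamCycle A h
  chord-right p<q q<M pq xq yp = close
    (up z≤n (≤-trans (<⇒≤ p<q) (<⇒≤ q<M)) ⟨ pq ⟩ down p<q (<⇒≤ q<M) ⟨ sym-A yp ⟩ down q<M ≤-refl) (sym-A xq)
    (↭-reflexive (partition₃ (s≤s (<⇒≤ p<q)) (s≤s (<⇒≤ q<M))))

  chord-left : ∀ {p q} → p < q → q < M → Adj A (v (suc p)) (v (suc q)) → x~ q → y~ p → HamCycle A h
  chord-left {p} {q} p<q q<M pq xq yp = close
    (up z≤n (≤-trans (<⇒≤ p<q) (<⇒≤ q<M)) ⟨ sym-A yp ⟩ down q<M ≤-refl ⟨ sym-A pq ⟩ up p<q (<⇒≤ q<M)) (sym-A xq)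
    (swap₃ (interval 0 (suc p)) (interval (suc p) (suc q)) _ (partition₃ (s≤s (<⇒≤ p<q)) (s≤s (<⇒≤ q<M))))

  -- Bypassing the central vertex v (m + 1) closes the rest of the path: from v 0 up to v m, to y,
  -- down to v (m + 2), back to v 0. Then v (m + 1) is inserted between its neighbours v b and v (b
  -- + 1). `skip-left` does the same on the other side.
  skip-right : ∀ {m b} → suc m < b → b < M → y~ m → x~ suc (suc m) →
               Adj A (v (suc m)) (v b) → Adj A (v (suc m)) (v (suc b)) → HamCycle A h
  skip-right {m} {b} m<b b<M ym xm mb mb′ = close
    (up z≤n m≤M ⟨ sym-A ym ⟩ down b<M ≤-refl ⟨ sym-A mb′ ⟩ up {suc m} ≤-refl (≤-trans (<⇒≤ m<b) (<⇒≤ b<M)) ⟨ mb ⟩ down m<b (<⇒≤ b<M)) (sym-A xm)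
    (rotateBCD (interval 0 (suc m)) (interval (suc m) (suc (suc m))) (interval (suc (suc m)) (suc b)) _
      (partition₄ (n≤1+n _) (≤-trans m<b (n≤1+n _)) (s≤s (<⇒≤ b<M))))
    where m≤M = ≤-trans (n≤1+n m) (≤-trans (<⇒≤ m<b) (<⇒≤ b<M))

  skip-left : ∀ {m b} → b < m → suc m < M → y~ m → x~ suc (suc m) →
              Adj A (v (suc m)) (v b) → Adj A (v (suc m)) (v (suc b)) → HamCycle A h
  skip-left {m} {b} b<m m<M ym xm mb mb′ = close
    (up z≤n (≤-trans (<⇒≤ b<m) m≤M) ⟨ sym-A mb ⟩ up {suc m} ≤-refl (<⇒≤ m<M) ⟨ mb′ ⟩ up b<m m≤M ⟨ sym-A ym ⟩ down m<M ≤-refl) (sym-A xm)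
    (swapBC (interval 0 (suc b)) (interval (suc b) (suc m)) (interval (suc m) (suc (suc m))) _
      (partition₄ (s≤s (<⇒≤ b<m)) (n≤1+n _) (s≤s (<⇒≤ m<M))))
    where m≤M = ≤-trans (n≤1+n m) (<⇒≤ m<M)

  -- Let v k ~ v a and x ~ v (a + 1) with k < a. Then v (k + 1) is the first vertex
  -- of a Hamiltonian path ending in y, and a further crossing closes that path.
  module SecondEnd {k a} (k<a : k < a) (a<M : a < M) (ka : Adj A (v k) (v a)) (xa : x~ suc a) where

    private
      k≤M = ≤-trans (<⇒≤ k<a) (<⇒≤ a<M)

    between : ∀ {b} → suc k ≤ b → b < a → Adj A (v (suc k)) (v (suc b)) → y~ b → HamCycle A h
    between {b} k<b b<a kb yb = close
      (up z≤n k≤M ⟨ ka ⟩ down b<a (<⇒≤ a<M) ⟨ sym-A kb ⟩ up k<b (≤-trans (<⇒≤ b<a) (<⇒≤ a<M)) ⟨ sym-A yb ⟩ down a<M ≤-refl) (sym-A xa)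
      (swapBC (interval 0 (suc k)) (interval (suc k) (suc b)) (interval (suc b) (suc a)) _
        (partition₄ (m≤n⇒m≤1+n k<b) (s≤s (<⇒≤ b<a)) (s≤s (<⇒≤ a<M))))

    beyond : ∀ {b} → a < b → b < M → Adj A (v (suc k)) (v (suc b)) → y~ b → HamCycle A h
    beyond {b} a<b b<M kb yb = close
      (up z≤n k≤M ⟨ ka ⟩ down k<a (<⇒≤ a<M) ⟨ kb ⟩ up b<M ≤-refl ⟨ yb ⟩ down a<b (<⇒≤ b<M)) (sym-A xa)
      (swapCD (interval 0 (suc k)) (interval (suc k) (suc a)) (interval (suc a) (suc b)) _
        (partition₄ (s≤s (<⇒≤ k<a)) (s≤s (<⇒≤ a<b)) (s≤s (<⇒≤ b<M))))

    before : ∀ {b} → b < k → Adj A (v (suc k)) (v b) → y~ suc b → HamCycle A h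
    before {b} b<k kb yb = close
      (up z≤n (≤-trans (<⇒≤ b<k) k≤M) ⟨ sym-A kb ⟩ up k<a (<⇒≤ a<M) ⟨ sym-A ka ⟩ down b<k k≤M ⟨ sym-A yb ⟩ down a<M ≤-refl) (sym-A xa)
      (swapBC (interval 0 (suc b)) (interval (suc b) (suc k)) (interval (suc k) (suc a)) _
        (partition₄ (s≤s (<⇒≤ b<k)) (s≤s (<⇒≤ k<a)) (s≤s (<⇒≤ a<M))))

-- Counting positions on a path

⟦⟧-disjoint₃ : ∀ {P Q R D : Set} (P? : Dec P) (Q? : Dec Q) (R? : Dec R) (D? : Dec D) →
  ¬ (P × Q) → ¬ (P × R) → ¬ (Q × R) → (P → D) → (Q → D) → (R → D) → ⟦ P? ⟧ + (⟦ Q? ⟧ + ⟦ R? ⟧) ≤ ⟦ D? ⟧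
⟦⟧-disjoint₃ (yes p) (yes q) _       _  ¬pq _ _ _ _ _ = contradiction (p , q) ¬pq
⟦⟧-disjoint₃ (yes p) (no _)  (yes r) _  _ ¬pr _ _ _ _ = contradiction (p , r) ¬pr
⟦⟧-disjoint₃ (yes p) (no _)  (no _)  D? _ _ _ f _ _   = ⟦⟧-yes D? (f p)
⟦⟧-disjoint₃ (no _)  (yes q) (yes r) _  _ _ ¬qr _ _ _ = contradiction (q , r) ¬qr
⟦⟧-disjoint₃ (no _)  (yes q) (no _)  D? _ _ _ _ g _   = ⟦⟧-yes D? (g q)
⟦⟧-disjoint₃ (no _)  (no _)  (yes r) D? _ _ _ _ _ k   = ⟦⟧-yes D? (k r)
⟦⟧-disjoint₃ (no _)  (no _)  (no _)  _  _ _ _ _ _ _   = z≤n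

prev : Pred ℕ 0ℓ → Pred ℕ 0ℓ
prev P zero    = ⊥
prev P (suc k) = P k

prev? : ∀ {P} → Decidable P → Decidable (prev P)
prev? P? zero    = no λ ()
prev? P? (suc k) = P? k

unique-range : ∀ i d → Unique (range i d)
unique-range i zero    = []
unique-range i (suc d) = All.tabulate (λ k∈ eq → <-irrefl eq (proj₁ (∈-range⁻ k∈))) ∷ unique-range (suc i) d

unique-↭ : ∀ {n} {xs ys : List (Fin n)} → xs ↭ ys → Unique xs → Unique ys
unique-↭ p = PermSetoid.Unique-resp-↭ (setoid _) (↭⇒↭ₛ p)

map-injective : ∀ {A B : Set} (f : A → B) {xs x y} → Unique (map f xs) → x ∈ xs → y ∈ xs → f x ≡ f y → x ≡ y
map-injective f _          (here refl) (here refl) _  = refl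
map-injective f (x∉ ∷ _)   (here refl) (there y∈)  eq = contradiction eq (All.lookup x∉ (∈-map⁺ f y∈))
map-injective f (y∉ ∷ _)   (there x∈)  (here refl) eq = contradiction (sym eq) (All.lookup y∉ (∈-map⁺ f x∈))
map-injective f (_ ∷ xs!)  (there x∈)  (there y∈)  eq = map-injective f xs! x∈ y∈ eq

∑-range-suc : ∀ i d f → ∑ (range (suc i) d) f ≡ ∑ (range i d) (f ∘ suc)
∑-range-suc i d f = cong sum (map-range f i d)

∑-range-last : ∀ d f → ∑ (range 0 (suc d)) f ≡ ∑ (range 0 d) f + f d
∑-range-last d f = begin
  ∑ (range 0 (suc d)) f                ≡⟨ cong (λ k → ∑ (range 0 k) f) (+-comm 1 d) ⟩
  ∑ (range 0 (d + 1)) f                ≡⟨ cong (λ l → ∑ l f) (range-++ 0 d 1) ⟩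
  ∑ (range 0 d ++ (d + 0 ∷ [])) f      ≡⟨ cong sum (List.map-++ f (range 0 d) (d + 0 ∷ [])) ⟩
  sum (map f (range 0 d) ++ (f (d + 0) ∷ [])) ≡⟨ sum-++ (map f (range 0 d)) (f (d + 0) ∷ []) ⟩
  ∑ (range 0 d) f + (f (d + 0) + 0)    ≡⟨ cong (∑ (range 0 d) f +_) (trans (+-identityʳ _) (cong f (+-identityʳ d))) ⟩
  ∑ (range 0 d) f + f d                ∎
  where open ≡-Reasoning

∑-ones : ∀ i d → ∑ (range i d) (λ _ → 1) ≡ d
∑-ones i zero    = refl
∑-ones i (suc d) = cong suc (∑-ones (suc i) d)

module Count (M : ℕ) where

  count : ∀ {P : Pred ℕ 0ℓ} → Decidable P → ℕ
  count P? = ∑ (range 0 (suc M)) (⟦_⟧ ∘ P?)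

  module _ {P : Pred ℕ 0ℓ} (P? : Decidable P) where

    -- Shifting a set of positions within 0, ..., M can change its size only at the border; in each
    -- of the next three lemmas the hypothesis excludes the one element that would leave or enter.
    count-prev : count (prev? P?) ≤ count P?
    count-prev = begin
      ∑ (range 1 M) (⟦_⟧ ∘ prev? P?)        ≡⟨ ∑-range-suc 0 M _ ⟩
      ∑ (range 0 M) (⟦_⟧ ∘ P?)              ≤⟨ m≤m+n _ _ ⟩
      ∑ (range 0 M) (⟦_⟧ ∘ P?) + ⟦ P? M ⟧   ≡⟨ ∑-range-last M _ ⟨
      count P?                              ∎
      where open ≤-Reasoning

    count-unprev : ¬ P M → count P? ≤ count (prev? P?)
    count-unprev ¬PM = begin
      count P?                              ≡⟨ ∑-range-last M _ ⟩
      ∑ (range 0 M) (⟦_⟧ ∘ P?) + ⟦ P? M ⟧   ≡⟨ cong (∑ (range 0 M) (⟦_⟧ ∘ P?) +_) (⟦⟧-no (P? M) ¬PM) ⟩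
      ∑ (range 0 M) (⟦_⟧ ∘ P?) + 0          ≡⟨ +-identityʳ _ ⟩
      ∑ (range 0 M) (⟦_⟧ ∘ P?)              ≡⟨ ∑-range-suc 0 M _ ⟨
      ∑ (range 1 M) (⟦_⟧ ∘ prev? P?)        ∎
      where open ≤-Reasoning

    count-suc : ¬ P (suc M) → count (P? ∘ suc) ≤ count P?
    count-suc ¬PN = begin
      ∑ (range 0 (suc M)) (⟦_⟧ ∘ P? ∘ suc)  ≡⟨ ∑-range-suc 0 (suc M) _ ⟨
      ∑ (range 1 (suc M)) (⟦_⟧ ∘ P?)        ≤⟨ m≤n+m _ ⟦ P? 0 ⟧ ⟩
      ∑ (range 0 (suc (suc M))) (⟦_⟧ ∘ P?)  ≡⟨ ∑-range-last (suc M) (⟦_⟧ ∘ P?) ⟩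
      count P? + ⟦ P? (suc M) ⟧             ≡⟨ cong (count P? +_) (⟦⟧-no (P? (suc M)) ¬PN) ⟩
      count P? + 0                          ≡⟨ +-identityʳ _ ⟩
      count P?                              ∎
      where open ≤-Reasoning

    count-unsuc : ¬ P 0 → count P? ≤ count (P? ∘ suc)
    count-unsuc ¬P0 = begin
      ⟦ P? 0 ⟧ + ∑ (range 1 M) (⟦_⟧ ∘ P?)           ≡⟨ cong (_+ ∑ (range 1 M) (⟦_⟧ ∘ P?)) (⟦⟧-no (P? 0) ¬P0) ⟩
      ∑ (range 1 M) (⟦_⟧ ∘ P?)                      ≡⟨ ∑-range-suc 0 M _ ⟩
      ∑ (range 0 M) (⟦_⟧ ∘ P? ∘ suc)                ≤⟨ m≤m+n _ _ ⟩
      ∑ (range 0 M) (⟦_⟧ ∘ P? ∘ suc) + ⟦ P? (suc M) ⟧ ≡⟨ ∑-range-last M _ ⟨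
      count (P? ∘ suc)                              ∎
      where open ≤-Reasoning

    count-mono : ∀ {Q : Pred ℕ 0ℓ} (Q? : Decidable Q) → (∀ {k} → k ≤ M → P k → Q k) → count P? ≤ count Q?
    count-mono Q? P⊆Q = ∑-mono (range 0 (suc M)) λ {k} k∈ → ⟦⟧-mono (P? k) (Q? k) (P⊆Q (≤-pred (proj₂ (∈-range⁻ k∈))))

    count-∈ : ∀ {k} → k ≤ M → P k → 1 ≤ count P?
    count-∈ {k} k≤M p = ≤-trans (⟦⟧-yes (P? k) p) (∑-∈ (⟦_⟧ ∘ P?) (∈-range⁺ z≤n (s≤s k≤M)))

  count-⊎ : ∀ {P Q R : Pred ℕ 0ℓ} (P? : Decidable P) (Q? : Decidable Q) (R? : Decidable R) →
            (∀ {k} → k ≤ M → R k → P k ⊎ Q k) → count R? ≤ count P? + count Q?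
  count-⊎ P? Q? R? f = ≤-trans
    (∑-mono (range 0 (suc M)) (λ {k} k∈ → ⟦⟧≤ (R? k) λ r → case f (≤-pred (proj₂ (∈-range⁻ k∈))) r of λ where
      (inj₁ p) → ≤-trans (⟦⟧-yes (P? k) p) (m≤m+n _ _)
      (inj₂ q) → ≤-trans (⟦⟧-yes (Q? k) q) (m≤n+m _ _)))
    (≤-reflexive (∑-+ (range 0 (suc M)) (⟦_⟧ ∘ P?) (⟦_⟧ ∘ Q?)))

  -- Only k ≡ m is counted twice.
  count-halves : ∀ {P : Pred ℕ 0ℓ} (P? : Decidable P) m →
    count (λ k → P? k ×-dec m ≤? k) + count (λ k → P? k ×-dec k ≤? m) ≤ suc (count P?)
  count-halves {P} P? m = begin
    count (λ k → P? k ×-dec m ≤? k) + count (λ k → P? k ×-dec k ≤? m)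
      ≡⟨ ∑-+ (range 0 (suc M)) (λ k → ⟦ P? k ×-dec m ≤? k ⟧) (λ k → ⟦ P? k ×-dec k ≤? m ⟧) ⟨
    ∑ (range 0 (suc M)) (λ k → ⟦ P? k ×-dec m ≤? k ⟧ + ⟦ P? k ×-dec k ≤? m ⟧)
      ≤⟨ ∑-mono (range 0 (suc M)) (λ {k} _ → pointwise k (k ≟ m)) ⟩
    ∑ (range 0 (suc M)) (λ k → ⟦ P? k ⟧ + ⟦ k ≟ m ⟧)
      ≡⟨ ∑-+ (range 0 (suc M)) (⟦_⟧ ∘ P?) (λ k → ⟦ k ≟ m ⟧) ⟩
    count P? + count (_≟ m)
      ≤⟨ +-monoʳ-≤ (count P?) (∑-atMostOne (_≟ m) (unique-range 0 (suc M)) (λ p q → trans p (sym q))) ⟩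
    count P? + 1
      ≡⟨ +-comm (count P?) 1 ⟩
    suc (count P?) ∎
    where
    open ≤-Reasoning
    pointwise : ∀ k (D : Dec (k ≡ m)) → ⟦ P? k ×-dec m ≤? k ⟧ + ⟦ P? k ×-dec k ≤? m ⟧ ≤ ⟦ P? k ⟧ + ⟦ D ⟧
    pointwise k (yes refl) = +-mono-≤ (⟦⟧-mono (P? k ×-dec m ≤? k) (P? k) proj₁) (⟦⟧≤1 (P? k ×-dec k ≤? m))
    pointwise k (no k≢m)   = ≤-trans (half (P? k)) (m≤m+n _ 0)
      where
      half : (D : Dec (P k)) → ⟦ D ×-dec m ≤? k ⟧ + ⟦ D ×-dec k ≤? m ⟧ ≤ ⟦ D ⟧
      half (yes p) = ⟦⟧-disjoint (yes p ×-dec m ≤? k) (yes p ×-dec k ≤? m) (λ ((_ , a) , (_ , b)) → k≢m (≤-antisym b a))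
      half (no ¬p) = ≤-refl

module Positions {n} {A : Graph (Fin n)} {h : Fin n} {M : ℕ} (P : HamPath A h M) where

  open HamPath P
  open Count M

  private
    unique : Unique (h ∷ map v (range 0 (suc M)))
    unique = unique-↭ (↭-sym spanning) (Unique.allFin⁺ n)

    find : ∀ u → Dec (u ∈ map v (range 0 (suc M)))
    find u = Any.any? (u Fin.≟_) _

  n≡2+M : n ≡ 2 + M
  n≡2+M = trans (sym (List.length-tabulate id)) (trans (sym (Perm.↭-length spanning))
    (cong suc (trans (List.length-map v (range 0 (suc M))) (length-range 0 (suc M)))))
    where
    length-range : ∀ i d → length (range i d) ≡ d
    length-range i zero    = refl
    length-range i (suc d) = cong suc (length-range (suc i) d)

  -- Only h is not on the path; it gets the dummy position 0, so every use of `pos` has to treat h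
  -- separately.
  pos : Fin n → ℕ
  pos u with find u
  ... | yes p = proj₁ (∈-map⁻ v p)
  ... | no _  = 0

  v-injective : ∀ {i j} → i ≤ M → j ≤ M → v i ≡ v j → i ≡ j
  v-injective i≤M j≤M = map-injective v (case unique of λ { (_ ∷ u) → u })
    (∈-range⁺ z≤n (s≤s i≤M)) (∈-range⁺ z≤n (s≤s j≤M))

  v≢h : ∀ {i} → i ≤ M → v i ≢ h
  v≢h i≤M eq = case unique of λ { (h∉ ∷ _) → All.lookup h∉ (∈-map⁺ v (∈-range⁺ z≤n (s≤s i≤M))) (sym eq) }

  pos-spec : ∀ {u} → u ≢ h → pos u ≤ M × v (pos u) ≡ u
  pos-spec {u} u≢h with find u
  ... | yes p with i , i∈ , eq ← ∈-map⁻ v p = ≤-pred (proj₂ (∈-range⁻ i∈)) , sym eq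
  ... | no u∉ with Perm.∈-resp-↭ (↭-sym spanning) (∈-allFin u)
  ...   | here u≡h = contradiction u≡h u≢h
  ...   | there u∈ = contradiction u∈ u∉

  pos-v : ∀ {i} → i ≤ M → pos (v i) ≡ i
  pos-v i≤M with p , eq ← pos-spec (v≢h i≤M) = v-injective p i≤M eq

  ∑-positions : ∀ f → ∑ (allFin n) f ≡ f h + ∑ (range 0 (suc M)) (f ∘ v)
  ∑-positions f = trans (sym (∑-perm f spanning)) (cong (f h +_) (∑-map v (range 0 (suc M)) f))

  -- The successor allows for an edge to h.
  deg≤ : ∀ u → deg A u ≤ suc (count (λ i → Adj? A u (v i)))
  deg≤ u = ≤-trans (≤-reflexive (∑-positions (⟦_⟧ ∘ Adj? A u))) (+-monoˡ-≤ _ (⟦⟧≤1 (Adj? A u h)))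

  module _ {Q : Pred ℕ 0ℓ} (Q? : Decidable Q) where

    -- `On` serves for sets to be isolated and is bounded from below; `OnOrHub` serves for deleted
    -- sets, which contain h as nothing is known of its edges, and is bounded from above.
    On OnOrHub : Pred (Fin n) 0ℓ
    On      u = u ≢ h × Q (pos u)
    OnOrHub u = u ≡ h ⊎ Q (pos u)

    on? : Decidable On
    on? u = ¬? (u Fin.≟ h) ×-dec Q? (pos u)

    onOrHub? : Decidable OnOrHub
    onOrHub? u = u Fin.≟ h ⊎-dec Q? (pos u)

    count≤#on : count Q? ≤ # on?
    count≤#on = begin
      count Q?                                     ≤⟨ ∑-mono (range 0 (suc M)) (λ {i} i∈ → let i≤M = ≤-pred (proj₂ (∈-range⁻ i∈)) in
                                                        ⟦⟧-mono (Q? i) (on? (v i)) (λ q → v≢h i≤M , subst Q (sym (pos-v i≤M)) q)) ⟩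
      ∑ (range 0 (suc M)) (⟦_⟧ ∘ on? ∘ v)          ≤⟨ m≤n+m _ ⟦ on? h ⟧ ⟩
      ⟦ on? h ⟧ + ∑ (range 0 (suc M)) (⟦_⟧ ∘ on? ∘ v) ≡⟨ ∑-positions (⟦_⟧ ∘ on?) ⟨
      # on?                                        ∎
      where open ≤-Reasoning

    #onOrHub≤ : # onOrHub? ≤ suc (count Q?)
    #onOrHub≤ = begin
      # onOrHub?                                        ≡⟨ ∑-positions (⟦_⟧ ∘ onOrHub?) ⟩
      ⟦ onOrHub? h ⟧ + ∑ (range 0 (suc M)) (⟦_⟧ ∘ onOrHub? ∘ v) ≤⟨ +-mono-≤ (⟦⟧≤1 (onOrHub? h))
        (∑-mono (range 0 (suc M)) λ {i} i∈ → let i≤M = ≤-pred (proj₂ (∈-range⁻ i∈)) in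
          ⟦⟧-mono (onOrHub? (v i)) (Q? i) λ where
            (inj₁ eq) → contradiction eq (v≢h i≤M)
            (inj₂ q)  → subst Q (pos-v i≤M) q) ⟩
      suc (count Q?)                                    ∎
      where open ≤-Reasoning

-- The closure lemma

private
  arith₁ : ∀ u p → 4 + u + p + 2 + (4 + u) ≡ p + 2 + (4 + u) * 2
  arith₁ = solve-∀
  arith₂ : ∀ u p τ → 4 + u + suc (suc τ + p) ≡ 4 + u + p + 2 + τ
  arith₂ = solve-∀
  arith₃ : ∀ u p r ν → (4 + u) * suc (4 + u + r) + ((ν + ν) + 4 * (p + 2))
    ≡ suc (2 + 3 * u + u * u + (2 + u) * r) + (suc (ν + ν) + ((4 + u + r + (p + p)) + (4 + u + r + (p + p)) + 4 * (4 + u)))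
  arith₃ = solve-∀

  -- Here τ counts the central positions, p the free edges, ν the positions in `Neither` and s the
  -- deleted vertices. The degree bound forces τ ≥ t, and then t(τ + 1) ≤ s ≤ 2ν + 1 ≤ 2τ + 4p + 1 ≤
  -- 2τ + 4t - 7 is impossible.
  arith-both : ∀ {t τ p ν s} → 4 ≤ t → p + 2 ≤ t → t * 2 ≤ suc (suc τ + p) → ν ≤ τ + (p + p) →
               t * suc τ ≤ s → s ≤ suc (ν + ν) → ⊥
  arith-both {t} {τ} {p} {ν} {s} 4≤t p+2≤t d≤ ν≤ iso s≤ = case m≤n⇒∃[o]m+o≡n 4≤t of λ where
    (u , refl) → case m≤n⇒∃[o]m+o≡n (cancel-≤ (4 + u + p + 2) {4 + u} {τ} (+-mono-≤ p+2≤t d≤) (arith₁ u p) (arith₂ u p τ)) of λ where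
      (r , refl) → ≤⇒⊥ (2 + 3 * u + u * u + (2 + u) * r)
        (+-mono-≤ (≤-trans iso s≤) (+-mono-≤ (+-mono-≤ ν≤ ν≤) (*-monoʳ-≤ 4 p+2≤t))) (arith₃ u p r ν)

module Closure
  {n t : ℕ} {A : Graph (Fin n)} {h : Fin n} {M : ℕ} (P : HamPath A h M)
  (tough : ToughByLabels t A) (4≤t : 4 ≤ t)
  (¬ham : ¬ HamCycle A h)
  (0<M : 0 < M)
  where

  open HamPath P
  open Rotations P
  open Count M
  open Positions P
  open ToughLemmas {t = t} {A = A} tough

  private
    sym-A = Graph.sym A
    irr : ∀ {u} → ¬ Adj A u u
    irr = Graph.irrefl A refl

    cross : ∀ {i} → i < M → x~ suc i → y~ i → ⊥
    cross i<M xi yi = ¬ham (crossing i<M xi yi)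

    α β : Pred ℕ 0ℓ
    α i = i ≤ M × x~ i
    β i = i ≤ M × y~ i

    α? : Decidable α
    α? i = i ≤? M ×-dec Adj? A (v 0) (v i)
    β? : Decidable β
    β? i = i ≤? M ×-dec Adj? A (v M) (v i)

    adj : ℕ → Pred ℕ 0ℓ
    adj m i = i ≤ M × Adj A (v m) (v i)
    adj? : ∀ m → Decidable (adj m)
    adj? m i = i ≤? M ×-dec Adj? A (v m) (v i)

  -- At most t − 2 edges (e , e + 1) of the path are free, and every position in Neither is
  -- in Both or an end of a free edge.
  Both Free Neither Gap : Pred ℕ 0ℓ
  Both k    = prev β k × α (suc k)
  Free e    = e < M × ¬ x~ (suc e) × ¬ y~ e
  Neither k = 0 < k × k < M × ¬ x~ k × ¬ y~ k
  Gap k     = ¬ prev β k × ¬ α (suc k)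

  both? : Decidable Both
  both? k = prev? β? k ×-dec α? (suc k)
  free? : Decidable Free
  free? e = e <? M ×-dec ¬? (Adj? A (v 0) (v (suc e))) ×-dec ¬? (Adj? A (v M) (v e))
  neither? : Decidable Neither
  neither? k = 0 <? k ×-dec k <? M ×-dec ¬? (Adj? A (v 0) (v k)) ×-dec ¬? (Adj? A (v M) (v k))
  gap? : Decidable Gap
  gap? k = ¬? (prev? β? k) ×-dec ¬? (α? (suc k))

  private
    β<M : ∀ {e} → β e → e < M
    β<M {e} (e≤M , y~e) = ≤∧≢⇒< e≤M λ { refl → irr y~e }

    α0 : ¬ α 0
    α0 (_ , xx) = irr xx

    βM : ¬ β M
    βM (_ , yy) = irr yy

    α-out : ¬ α (suc M)
    α-out (N≤M , _) = <-irrefl refl N≤M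

    sum-split : ∀ {P Q R : Pred ℕ 0ℓ} (P? : Decidable P) (Q? : Decidable Q) (R? : Decidable R) →
      count P? + (count Q? + count R?) ≡ ∑ (range 0 (suc M)) (λ k → ⟦ P? k ⟧ + (⟦ Q? k ⟧ + ⟦ R? k ⟧))
    sum-split P? Q? R? = sym (trans (∑-+ (range 0 (suc M)) (⟦_⟧ ∘ P?) (λ k → ⟦ Q? k ⟧ + ⟦ R? k ⟧))
      (cong (count P? +_) (∑-+ (range 0 (suc M)) (⟦_⟧ ∘ Q?) (⟦_⟧ ∘ R?))))

    -- For each edge (e , e + 1) at most one of "free", x ~ v (e + 1), y ~ v e holds, since the last
    -- two together are a crossing.
    free-count : count free? + (count α? + count β?) ≤ M
    free-count = begin
      count free? + (count α? + count β?)            ≤⟨ +-monoʳ-≤ (count free?) (+-monoˡ-≤ (count β?) (count-unsuc α? α0)) ⟩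
      count free? + (count (α? ∘ suc) + count β?)    ≡⟨ sum-split free? (α? ∘ suc) β? ⟩
      ∑ (range 0 (suc M)) (λ k → ⟦ free? k ⟧ + (⟦ α? (suc k) ⟧ + ⟦ β? k ⟧))
        ≤⟨ ∑-mono (range 0 (suc M)) (λ {k} _ → ⟦⟧-disjoint₃ (free? k) (α? (suc k)) (β? k) (k <? M)
             (λ ((_ , ¬x , _) , (_ , x)) → ¬x x) (λ ((_ , _ , ¬y) , (_ , y)) → ¬y y)
             (λ ((k<M , x) , (_ , y)) → cross k<M x y) proj₁ proj₁ β<M) ⟩
      ∑ (range 0 (suc M)) (λ k → ⟦ k <? M ⟧)         ≡⟨ ∑-range-last M (λ k → ⟦ k <? M ⟧) ⟩
      ∑ (range 0 M) (λ k → ⟦ k <? M ⟧) + ⟦ M <? M ⟧  ≡⟨ cong (∑ (range 0 M) (λ k → ⟦ k <? M ⟧) +_) (⟦⟧-no (M <? M) (<-irrefl refl)) ⟩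
      ∑ (range 0 M) (λ k → ⟦ k <? M ⟧) + 0           ≡⟨ +-identityʳ _ ⟩
      ∑ (range 0 M) (λ k → ⟦ k <? M ⟧)               ≤⟨ ∑-mono (range 0 M) (λ {k} _ → ⟦⟧≤1 (k <? M)) ⟩
      ∑ (range 0 M) (λ _ → 1)                        ≡⟨ ∑-ones 0 M ⟩
      M                                              ∎
      where
      open ≤-Reasoning

    -- The same count centred at vertices instead of edges; the absence of central positions
    -- replaces that of crossings.
    gap-count : (∀ k → ¬ Both k) → count gap? + (count α? + count β?) ≤ suc M
    gap-count ¬both = begin
      count gap? + (count α? + count β?)
        ≤⟨ +-monoʳ-≤ (count gap?) (+-mono-≤ (count-unsuc α? α0) (count-unprev β? βM)) ⟩
      count gap? + (count (α? ∘ suc) + count (prev? β?))  ≡⟨ sum-split gap? (α? ∘ suc) (prev? β?) ⟩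
      ∑ (range 0 (suc M)) (λ k → ⟦ gap? k ⟧ + (⟦ α? (suc k) ⟧ + ⟦ prev? β? k ⟧))
        ≤⟨ ∑-mono (range 0 (suc M)) (λ {k} _ → ⟦⟧-disjoint₃ (gap? k) (α? (suc k)) (prev? β? k) (yes tt)
             (λ ((_ , ¬a) , a) → ¬a a) (λ ((¬b , _) , b) → ¬b b) (λ (a , b) → ¬both k (b , a)) _ _ _) ⟩
      ∑ (range 0 (suc M)) (λ _ → 1)                  ≡⟨ ∑-ones 0 (suc M) ⟩
      suc M                                          ∎
      where
      open ≤-Reasoning

    -- If the position is not central, then y misses its predecessor or x misses its successor; the
    -- path edge towards that vertex is free.
    neither⇒ : ∀ {k} → Neither k → Both k ⊎ (prev Free k ⊎ Free k)
    neither⇒ {suc k} (_ , k<M , ¬x , ¬y) with Adj? A (v M) (v k) | Adj? A (v 0) (v (suc (suc k)))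
    ... | yes y | yes x  = inj₁ ((≤-trans (n≤1+n k) (<⇒≤ k<M) , y) , (k<M , x))
    ... | no ¬yk | _     = inj₂ (inj₁ (≤-trans (n≤1+n _) k<M , ¬x , ¬yk))
    ... | yes _ | no ¬xk = inj₂ (inj₂ (k<M , ¬xk , ¬y))

    neither-count : count neither? ≤ count both? + (count free? + count free?)
    neither-count = ≤-trans
      (count-⊎ both? (λ k → prev? free? k ⊎-dec free? k) neither? (λ _ → neither⇒))
      (+-monoʳ-≤ (count both?) (≤-trans
        (count-⊎ (prev? free?) free? (λ k → prev? free? k ⊎-dec free? k) (λ _ p → p))
        (+-monoˡ-≤ (count free?) (count-prev free?))))

  -- From every neighbour of v m on the path, one step towards v m leads to a vertex adjacent to
  -- neither end. A hemmed vertex thus has few neighbours.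
  record Hemmed (m : ℕ) : Set where
    field
      right : ∀ {b} → m ≤ b → b < M → Adj A (v m) (v (suc b)) → Neither b
      left  : ∀ {b} → b < m → Adj A (v m) (v b) → Neither (suc b)

  both-hemmed : ∀ {m} → Both m → Hemmed m
  both-hemmed {suc m} ((_ , ym) , (m<M , xm)) = record
    { right = λ {b} m≤b b<M e → ≤-trans (s≤s z≤n) m≤b , b<M
        , (λ xb → ¬ham (chord-left m≤b b<M e xb ym))
        , (λ yb → case m≤n⇒m<n∨m≡n m≤b of λ where
            (inj₁ m<b)  → ¬ham (chord-inner m<b b<M e xm yb)
            (inj₂ refl) → cross b<M xm yb)
    ; left  = λ {b} b<m e → s≤s z≤n , ≤-trans (s≤s b<m) m<M
        , (λ xb → case m≤n⇒m<n∨m≡n (≤-pred b<m) of λ where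
            (inj₁ b<m′) → ¬ham (chord-inner b<m′ (≤-trans (n≤1+n _) m<M) (sym-A e) xb ym)
            (inj₂ refl) → cross (≤-trans (n≤1+n _) m<M) xb ym)
        , (λ yb → ¬ham (chord-right b<m m<M (sym-A e) xm yb)) }

  -- The edge y ~ v k excludes neighbours of x as for a central vertex; neighbours of y are excluded
  -- mainly by crossings on the second path, which starts at v (k + 1).
  second-hemmed : ∀ {k a} → k < a → a < M → Adj A (v k) (v a) → x~ suc a → y~ k → Hemmed (suc k)
  second-hemmed {k} {a} k<a a<M ka xa yk = record
    { right = λ {b} k<b b<M e → ≤-trans (s≤s z≤n) k<b , b<M
        , (λ xb → ¬ham (chord-left k<b b<M e xb yk))
        , (λ yb → case <-cmp b a of λ where
            (tri< b<a _ _)  → ¬ham (between k<b b<a e yb)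
            (tri≈ _ refl _) → cross a<M xa yb
            (tri> _ _ a<b)  → ¬ham (beyond a<b b<M e yb))
    ; left  = λ {b} b<sk e → s≤s z≤n , ≤-trans (s≤s b<sk) (≤-trans (s≤s k<a) a<M)
        , (λ xb → case m≤n⇒m<n∨m≡n (≤-pred b<sk) of λ where
            (inj₁ b<k)  → ¬ham (chord-inner b<k k<M (sym-A e) xb yk)
            (inj₂ refl) → cross k<M xb yk)
        , (λ yb → case m≤n⇒m<n∨m≡n (≤-pred b<sk) of λ where
            (inj₁ b<k)  → ¬ham (before b<k e yb)
            (inj₂ refl) → ¬ham (chord-right k<a a<M ka xa yb)) }
    where
    open SecondEnd k<a a<M ka xa
    k<M = ≤-trans k<a (<⇒≤ a<M)

  -- Stepping from each neighbour towards m lands in `Neither` and is injective, except that m - 1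
  -- and m + 1 both land on m.
  hemmed-degree : ∀ {m} → Hemmed m → count (adj? m) ≤ suc (count neither?)
  hemmed-degree {m} hem = begin
    count (adj? m)                          ≤⟨ count-⊎ (prev? right?) (left? ∘ suc) (adj? m) (λ _ → split) ⟩
    count (prev? right?) + count (left? ∘ suc) ≤⟨ +-mono-≤ (count-prev right?) (count-suc left? (λ ((_ , N<M , _) , _) → <-irrefl refl (≤-trans (n≤1+n _) N<M))) ⟩
    count right? + count left?              ≤⟨ count-halves neither? m ⟩
    suc (count neither?)                    ∎
    where
    open ≤-Reasoning
    open Hemmed hem
    right? : Decidable (λ k → Neither k × m ≤ k)
    right? k = neither? k ×-dec m ≤? k
    left? : Decidable (λ k → Neither k × k ≤ m)
    left? k = neither? k ×-dec k ≤? m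
    split : ∀ {b} → adj m b → prev (λ k → Neither k × m ≤ k) b ⊎ (Neither (suc b) × suc b ≤ m)
    split {b} (b≤M , e) with <-cmp b m
    ... | tri< b<m _ _  = inj₂ (left b<m e , b<m)
    ... | tri≈ _ refl _ = contradiction e irr
    split {suc b} (b≤M , e) | tri> _ _ (s≤s m≤b) = inj₁ (right m≤b b≤M e , m≤b)

  -- No two neighbours of v m are consecutive, so every free edge is responsible for
  -- at most one of them.
  both-degree : ∀ {m} → m ≤ M → Both m → count (adj? m) ≤ suc (count both?) + count free?
  both-degree {suc m′} m≤M bm@((_ , ym) , (m<M , xm)) = begin
    count (adj? m)
      ≤⟨ count-⊎ bs? fs? (adj? m) (λ _ → split) ⟩
    count bs? + count fs?
      ≤⟨ +-mono-≤ bs-count fs-count ⟩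
    suc (count both?) + count free? ∎
    where
    open ≤-Reasoning
    m = suc m′
    open Hemmed (both-hemmed bm)
    right? : Decidable (λ k → Both k × m ≤ k)
    right? k = both? k ×-dec m ≤? k
    left? : Decidable (λ k → Both k × k ≤ m)
    left? k = both? k ×-dec k ≤? m
    Bs : Pred ℕ 0ℓ
    Bs b = prev (λ k → Both k × m ≤ k) b ⊎ (Both (suc b) × suc b ≤ m)
    bs? : Decidable Bs
    bs? b = prev? right? b ⊎-dec left? (suc b)
    -- A free edge e can be charged by the neighbours at e + 2 and e + 1 if these lie to the right
    -- of m (U₁, U₂), or at e and e - 1 if to the left (U₃, U₄). Each pair is consecutive, so
    -- `skip-right` and `skip-left` allow only one of it. The two edges at m are not free as m is
    -- central, so no edge is charged from both sides.
    U₁ U₂ U₃ U₄ Fs : Pred ℕ 0ℓ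
    U₁ e = Free e × m ≤ suc e × adj m (suc (suc e))
    U₂ e = Free e × m ≤ e × adj m (suc e)
    U₃ e = Free e × e < m × adj m e
    U₄ e = Free e × prev (λ b → b < m × adj m b) e
    U₁? : Decidable U₁
    U₁? e = free? e ×-dec m ≤? suc e ×-dec adj? m (suc (suc e))
    U₂? : Decidable U₂
    U₂? e = free? e ×-dec m ≤? e ×-dec adj? m (suc e)
    U₃? : Decidable U₃
    U₃? e = free? e ×-dec e <? m ×-dec adj? m e
    U₄? : Decidable U₄
    U₄? e = free? e ×-dec prev? (λ b → b <? m ×-dec adj? m b) e
    Fs b = (prev (prev U₁) b ⊎ prev U₂ b) ⊎ (U₃ b ⊎ U₄ (suc b))
    fs? : Decidable Fs
    fs? b = (prev? (prev? U₁?) b ⊎-dec prev? U₂? b) ⊎-dec (U₃? b ⊎-dec U₄? (suc b))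
    split : ∀ {b} → adj m b → Bs b ⊎ Fs b
    split {b} (b≤M , e) with <-cmp b m
    ... | tri≈ _ refl _ = contradiction e irr
    split {b} (b≤M , e) | tri< b<m _ _ with neither⇒ (left b<m e)
    ... | inj₁ both      = inj₁ (inj₂ (both , b<m))
    ... | inj₂ (inj₁ fr) = inj₂ (inj₂ (inj₁ (fr , b<m , b≤M , e)))
    ... | inj₂ (inj₂ fr) = inj₂ (inj₂ (inj₂ (fr , b<m , b≤M , e)))
    split {suc b} (b≤M , e) | tri> _ _ (s≤s m≤b) with neither⇒ (right m≤b b≤M e)
    ... | inj₁ both      = inj₁ (inj₁ (both , m≤b))
    ... | inj₂ (inj₂ fr) = inj₂ (inj₁ (inj₂ (fr , m≤b , b≤M , e)))
    split {suc (suc b)} (b≤M , e) | tri> _ _ (s≤s m≤b) | inj₂ (inj₁ fr) = inj₂ (inj₁ (inj₁ (fr , m≤b , b≤M , e)))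
    bs-count : count bs? ≤ suc (count both?)
    bs-count = begin
      count bs?                                  ≤⟨ count-⊎ (prev? right?) (left? ∘ suc) bs? (λ _ p → p) ⟩
      count (prev? right?) + count (left? ∘ suc) ≤⟨ +-mono-≤ (count-prev right?) (count-suc left? (λ ((_ , (N<M , _)) , _) → <-irrefl refl (≤-trans (n≤1+n _) N<M))) ⟩
      count right? + count left?                 ≤⟨ count-halves both? m ⟩
      suc (count both?)                          ∎
    m≢free : ¬ Free m
    m≢free (_ , ¬x , _) = ¬x xm
    m′≢free : ¬ Free m′
    m′≢free (_ , _ , ¬y) = ¬y ym
    pointwise : ∀ e → (⟦ U₁? e ⟧ + ⟦ U₂? e ⟧) + (⟦ U₃? e ⟧ + ⟦ U₄? e ⟧) ≤ ⟦ free? e ⟧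
    pointwise e = go (free? e) (<-cmp e m)
      where
      u₁ = ⟦ U₁? e ⟧
      u₂ = ⟦ U₂? e ⟧
      u₃ = ⟦ U₃? e ⟧
      u₄ = ⟦ U₄? e ⟧
      drop₁₂ : ∀ {k} → u₁ ≡ 0 → u₂ ≡ 0 → u₃ + u₄ ≤ k → (u₁ + u₂) + (u₃ + u₄) ≤ k
      drop₁₂ p q le rewrite p | q = le
      drop₃₄ : ∀ {k} → u₃ ≡ 0 → u₄ ≡ 0 → u₁ + u₂ ≤ k → (u₁ + u₂) + (u₃ + u₄) ≤ k
      drop₃₄ p q le rewrite p | q = ≤-trans (≤-reflexive (+-identityʳ (u₁ + u₂))) le
      U₄< : U₄ e → e < m
      U₄< = U₄<′ e
        where
        U₄<′ : ∀ e → U₄ e → e < m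
        U₄<′ (suc b) (fr , b<m , _) = ≤∧≢⇒< b<m λ { refl → m≢free fr }
      U₁> : U₁ e → m < e
      U₁> (fr , m≤e+1 , _) with m≤n⇒m<n∨m≡n (≤-pred m≤e+1)
      ... | inj₂ refl = contradiction fr m′≢free
      ... | inj₁ m≤e  = ≤∧≢⇒< m≤e λ { refl → m≢free fr }
      U₃U₄ : ∀ e → ¬ (U₃ e × U₄ e)
      U₃U₄ (suc b) ((_ , b+1<m , _ , e′) , (fr , _ , _ , e)) with m≤n⇒m<n∨m≡n (≤-pred b+1<m)
      ... | inj₁ b+1<m′ = ¬ham (skip-left (≤-trans (n≤1+n _) b+1<m′) m<M ym xm e e′)
      ... | inj₂ refl   = m′≢free fr
      go : (D : Dec (Free e)) → Tri (e < m) (e ≡ m) (m < e) → (⟦ U₁? e ⟧ + ⟦ U₂? e ⟧) + (⟦ U₃? e ⟧ + ⟦ U₄? e ⟧) ≤ ⟦ D ⟧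
      go (no ¬f) _ = drop₁₂ (⟦⟧-no (U₁? e) (¬f ∘ proj₁)) (⟦⟧-no (U₂? e) (¬f ∘ proj₁))
        (≤-reflexive (cong₂ _+_ (⟦⟧-no (U₃? e) (¬f ∘ proj₁)) (⟦⟧-no (U₄? e) (¬f ∘ proj₁))))
      go (yes f) (tri< e<m _ _) = drop₁₂
        (⟦⟧-no (U₁? e) (λ u → <-asym e<m (U₁> u))) (⟦⟧-no (U₂? e) (λ (_ , m≤e , _) → <⇒≱ e<m m≤e))
        (⟦⟧-disjoint (U₃? e) (U₄? e) (U₃U₄ e))
      go (yes f) (tri≈ _ refl _) = contradiction f m≢free
      go (yes f) (tri> _ _ m<e) = drop₃₄
        (⟦⟧-no (U₃? e) (λ (_ , e<m , _) → <-asym e<m m<e)) (⟦⟧-no (U₄? e) (λ u → <-asym (U₄< u) m<e))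
        (⟦⟧-disjoint (U₁? e) (U₂? e) (λ ((_ , _ , b<M , e′) , (_ , _ , _ , e₀)) → ¬ham (skip-right (m≤n⇒m≤1+n m<e) b<M ym xm e₀ e′)))
    fs-count : count fs? ≤ count free?
    fs-count = begin
      count fs?
        ≤⟨ count-⊎ (λ b → prev? (prev? U₁?) b ⊎-dec prev? U₂? b) (λ b → U₃? b ⊎-dec U₄? (suc b)) fs? (λ _ p → p) ⟩
      count (λ b → prev? (prev? U₁?) b ⊎-dec prev? U₂? b) + count (λ b → U₃? b ⊎-dec U₄? (suc b))
        ≤⟨ +-mono-≤ (count-⊎ (prev? (prev? U₁?)) (prev? U₂?) (λ b → prev? (prev? U₁?) b ⊎-dec prev? U₂? b) (λ _ p → p))
                    (count-⊎ U₃? (U₄? ∘ suc) (λ b → U₃? b ⊎-dec U₄? (suc b)) (λ _ p → p)) ⟩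
      (count (prev? (prev? U₁?)) + count (prev? U₂?)) + (count U₃? + count (U₄? ∘ suc))
        ≤⟨ +-mono-≤ (+-mono-≤ (≤-trans (count-prev (prev? U₁?)) (count-prev U₁?)) (count-prev U₂?))
                    (+-monoʳ-≤ (count U₃?) (count-suc U₄? (λ ((N<M , _) , _) → <-irrefl refl (≤-trans (n≤1+n _) N<M)))) ⟩
      (count U₁? + count U₂?) + (count U₃? + count U₄?)
        ≡⟨ cong₂ _+_ (∑-+ (range 0 (suc M)) (⟦_⟧ ∘ U₁?) (⟦_⟧ ∘ U₂?)) (∑-+ (range 0 (suc M)) (⟦_⟧ ∘ U₃?) (⟦_⟧ ∘ U₄?)) ⟨
      ∑ (range 0 (suc M)) (λ e → ⟦ U₁? e ⟧ + ⟦ U₂? e ⟧) + ∑ (range 0 (suc M)) (λ e → ⟦ U₃? e ⟧ + ⟦ U₄? e ⟧)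
        ≡⟨ ∑-+ (range 0 (suc M)) (λ e → ⟦ U₁? e ⟧ + ⟦ U₂? e ⟧) (λ e → ⟦ U₃? e ⟧ + ⟦ U₄? e ⟧) ⟨
      ∑ (range 0 (suc M)) (λ e → (⟦ U₁? e ⟧ + ⟦ U₂? e ⟧) + (⟦ U₃? e ⟧ + ⟦ U₄? e ⟧))
        ≤⟨ ∑-mono (range 0 (suc M)) (λ {e} _ → pointwise e) ⟩
      count free? ∎

  private
    2t≤ : ∀ {m} → m ≤ M → 0 < m → ¬ x~ m → t * 2 ≤ suc (count (adj? m))
    2t≤ {m} m≤M 0<m x≁m = begin
      t * 2                                 ≤⟨ 2t≤deg {v m} {v 0} (λ eq → <⇒≢ 0<m (sym (v-injective m≤M z≤n eq))) (λ e → x≁m (sym-A e)) ⟩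
      deg A (v m)                           ≤⟨ deg≤ (v m) ⟩
      suc (count (λ i → Adj? A (v m) (v i))) ≤⟨ s≤s (count-mono (λ i → Adj? A (v m) (v i)) (adj? m) _,_) ⟩
      suc (count (adj? m))                  ∎
      where open ≤-Reasoning

    u≡v : ∀ {u} → u ≢ h → v (pos u) ≡ u
    u≡v = proj₂ ∘ pos-spec

    edge : ∀ {u w} → u ≢ h → w ≢ h → Adj A u w → Adj A (v (pos u)) (v (pos w))
    edge u≢h w≢h = subst₂ (Adj A) (sym (u≡v u≢h)) (sym (u≡v w≢h))

  -- Central vertices are hemmed, so all their neighbours are h or next to a position in `Neither`.
  -- Deleting these vertices isolates all central vertices at once, while x survives as a further
  -- component.
  both-empty : count free? + 2 ≤ t → ∀ k → ¬ Both k
  both-empty p+2≤t k both = arith-both 4≤t p+2≤t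
      (≤-trans (2t≤ k≤M (0<k both) (x≁k both)) (s≤s (both-degree k≤M both)))
      neither-count iso size
    where
    k≤M : k ≤ M
    k≤M = ≤-trans (n≤1+n k) (proj₁ (proj₂ both))
    0<k : ∀ {k} → Both k → 0 < k
    0<k {suc k} _ = s≤s z≤n
    x≁k : ∀ {k} → Both k → ¬ x~ k
    x≁k {suc k} ((_ , y) , (k+2≤M , _)) x = cross (≤-trans (n≤1+n _) k+2≤M) x y
    Near : Pred ℕ 0ℓ
    Near b = prev Neither b ⊎ Neither (suc b)
    near? : Decidable Near
    near? b = prev? neither? b ⊎-dec neither? (suc b)
    size : # (onOrHub? near?) ≤ suc (count neither? + count neither?)
    size = ≤-trans (#onOrHub≤ near?) (s≤s (≤-trans (count-⊎ (prev? neither?) (neither? ∘ suc) near? (λ _ p → p))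
      (+-mono-≤ (count-prev neither?) (count-suc neither? (λ (_ , N<M , _) → <-irrefl refl (≤-trans (n≤1+n _) N<M))))))
    both-near : ∀ {k} → Both k → ¬ Near k
    both-near {suc k} ((_ , y) , _)  (inj₁ (_ , _ , _ , ¬y)) = ¬y y
    both-near {suc k} (_ , (_ , x)) (inj₂ (_ , _ , ¬x , _)) = ¬x x
    hemmed-near : ∀ {k b} → Hemmed k → b ≤ M → Adj A (v k) (v b) → Near b
    hemmed-near {k} {b} hem b≤M e with <-cmp b k
    ... | tri< b<k _ _  = inj₂ (Hemmed.left hem b<k e)
    ... | tri≈ _ refl _ = contradiction e irr
    hemmed-near {b = suc b} hem b≤M e | tri> _ _ (s≤s k≤b) = inj₁ (Hemmed.right hem k≤b b≤M e)
    pos-0 : pos (v 0) ≡ 0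
    pos-0 = pos-v z≤n
    iso : t * suc (count both?) ≤ # (onOrHub? near?)
    iso = ≤-trans (*-monoʳ-≤ t (s≤s (count≤#on both?))) (isolated (on? both?) (onOrHub? near?) {v 0}
      (λ (_ , b) → case subst Both pos-0 b of λ ())
      (λ { (inj₁ eq) → v≢h z≤n eq
         ; (inj₂ near) → case subst Near pos-0 near of λ { (inj₁ ()) ; (inj₂ (_ , _ , ¬x , _)) → ¬x (path 0<M) } })
      (λ { (u≢h , b) (inj₁ eq) → u≢h eq ; (u≢h , b) (inj₂ near) → both-near b near })
      (λ {u} {w} (u≢h , b) e → case w Fin.≟ h of λ where
        (yes eq)  → inj₁ eq
        (no w≢h) → inj₂ (hemmed-near (both-hemmed b) (proj₁ (pos-spec w≢h)) (edge u≢h w≢h e)))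
      (≤-trans (count-∈ both? k≤M both) (count≤#on both?)))

  -- Without positions in Both, deleting h, the gaps and the free ends of y-runs
  -- separates the predecessors of neighbours of x from the successors of neighbours of y.
  closure-⊥ : n ≤ count α? + count β? + t → ⊥
  closure-⊥ n≤ = ≤⇒⊥ 1 (+-mono-≤ (≤-trans t2≤S size) (+-mono-≤ q+1≤t p+2≤t)) (lem₃ (count gap?) (count free?) t)
    where
    2+M≤ : 2 + M ≤ count α? + count β? + t
    2+M≤ = ≤-trans (≤-reflexive (sym n≡2+M)) n≤
    p+2≤t : count free? + 2 ≤ t
    p+2≤t = cancel-≤ (count α? + count β? + M) (+-mono-≤ free-count 2+M≤)
      (lem₁ (count α?) (count β?) (count free?) M) (lem₂ (count α?) (count β?) M t)
      where
      lem₁ : ∀ a b f m → a + b + m + (f + 2) ≡ f + (a + b) + (2 + m)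
      lem₁ = solve-∀
      lem₂ : ∀ a b m t → m + (a + b + t) ≡ a + b + m + t
      lem₂ = solve-∀
    ¬both : ∀ k → ¬ Both k
    ¬both = both-empty p+2≤t
    q+1≤t : count gap? + 1 ≤ t
    q+1≤t = cancel-≤ (count α? + count β? + suc M) (+-mono-≤ (gap-count ¬both) 2+M≤)
      (lem₁ (count α?) (count β?) (count gap?) M) (lem₂ (count α?) (count β?) M t)
      where
      lem₁ : ∀ a b f m → a + b + suc m + (f + 1) ≡ f + (a + b) + (2 + m)
      lem₁ = solve-∀
      lem₂ : ∀ a b m t → suc m + (a + b + t) ≡ a + b + suc m + t
      lem₂ = solve-∀
    lem₃ : ∀ q p t → t * 2 + (q + 1 + (p + 2)) ≡ suc 1 + (suc (q + p) + (t + t))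
    lem₃ = solve-∀
    RunEnd Cut : Pred ℕ 0ℓ
    RunEnd b = prev β b × Free b
    Cut b = Gap b ⊎ RunEnd b
    runEnd? : Decidable RunEnd
    runEnd? b = prev? β? b ×-dec free? b
    cut? : Decidable Cut
    cut? b = gap? b ⊎-dec runEnd? b
    size : # (onOrHub? cut?) ≤ suc (count gap? + count free?)
    size = ≤-trans (#onOrHub≤ cut?) (s≤s (≤-trans (count-⊎ gap? runEnd? cut? (λ _ p → p))
      (+-monoʳ-≤ (count gap?) (count-mono runEnd? free? (λ _ → proj₂)))))
    -- Without central positions `Neither` has at most 2t - 4 elements, so a hemmed vertex has
    -- degree at most 2t - 2, counting h and the position hit twice.
    hemmed-⊥ : ∀ {m} → m ≤ M → 0 < m → ¬ x~ m → Hemmed m → ⊥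
    hemmed-⊥ m≤M 0<m x≁m hem = ≤⇒⊥ 1
      (+-mono-≤ (≤-trans (2t≤ m≤M 0<m x≁m) (s≤s (≤-trans (hemmed-degree hem) (s≤s neither≤)))) (+-mono-≤ p+2≤t p+2≤t))
      (lem (count free?) t)
      where
      neither≤ : count neither? ≤ count free? + count free?
      neither≤ = subst (λ c → count neither? ≤ c + (count free? + count free?))
        (∑-none (range 0 (suc M)) both? (λ _ → ¬both _)) neither-count
      lem : ∀ p t → t * 2 + (p + 2 + (p + 2)) ≡ suc 1 + (suc (suc (p + p)) + (t + t))
      lem = solve-∀
    -- If a < b, a crossing or `chord-inner` closes the path. If b < a, the edge rotates the path so
    -- that it starts at v (b + 1), and this vertex is hemmed.
    noEdge : ∀ {a b} → b ≤ M → α (suc a) → prev β b → ¬ RunEnd b → ¬ Adj A (v a) (v b)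
    noEdge {a} {suc b} b<M (a<M , xa) (_ , yb) ¬end e with <-cmp a (suc b)
    ... | tri≈ _ refl _ = irr e
    ... | tri< a<b _ _  = case m≤n⇒m<n∨m≡n (≤-pred a<b) of λ where
      (inj₁ a<b′) → ¬ham (chord-inner a<b′ b<M e xa yb)
      (inj₂ refl) → cross a<M xa yb
    ... | tri> _ _ b<a  = hemmed-⊥ k+1≤M (s≤s z≤n) (λ x → cross k+1≤M x yk) (second-hemmed b<a a<M (sym-A e) xa yk)
      where
      k+1≤M : suc (suc b) ≤ M
      k+1≤M = ≤-trans b<a (<⇒≤ a<M)
      -- Otherwise the edge leaving position b + 1 is free, since x ~ v (b + 2) would make b + 1
      -- central; then b + 1 is a `RunEnd`.
      yk : y~ suc b
      yk = decidable-stable (Adj? A (v M) (v (suc b))) λ ¬y →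
        ¬end ((<⇒≤ b<M , yb) , (k+1≤M , (λ x → ¬both (suc b) ((<⇒≤ b<M , yb) , (k+1≤M , x))) , ¬y))
    g : Fin n → Fin n
    g u with α? (suc (pos u))
    ... | yes _ = v 0
    ... | no _  = v M
    inv : ∀ {u w} → ¬ OnOrHub cut? u → ¬ OnOrHub cut? w → Adj A u w → g u ≡ g w
    inv {u} {w} ¬u ¬w e with α? (suc (pos u)) | α? (suc (pos w))
    ... | yes _ | yes _ = refl
    ... | no _  | no _  = refl
    ... | yes a | no ¬b = contradiction (edge (¬u ∘ inj₁) (¬w ∘ inj₁) e)
      (noEdge (proj₁ (pos-spec (¬w ∘ inj₁))) a
        (decidable-stable (prev? β? (pos w)) (λ ¬β → ¬w (inj₂ (inj₁ (¬β , ¬b)))))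
        (λ end → ¬w (inj₂ (inj₂ end))))
    ... | no ¬b | yes a = contradiction (edge (¬w ∘ inj₁) (¬u ∘ inj₁) (sym-A e))
      (noEdge (proj₁ (pos-spec (¬u ∘ inj₁))) a
        (decidable-stable (prev? β? (pos u)) (λ ¬β → ¬u (inj₂ (inj₁ (¬β , ¬b)))))
        (λ end → ¬u (inj₂ (inj₂ end))))
    x? y? : Decidable _
    x? u = u Fin.≟ v 0
    y? u = u Fin.≟ v M
    R? : Decidable (λ u → u ≡ v 0 ⊎ u ≡ v M)
    R? u = x? u ⊎-dec y? u
    2≤R : 2 ≤ # R?
    2≤R = ≤-trans (≤-reflexive (sym (cong₂ _+_ (#-≡ (v 0)) (#-≡ (v M)))))
      (#-disjoint x? y? R? (λ { (refl , eq) → <⇒≢ 0<M (v-injective z≤n ≤-refl eq) }) (λ p → p))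
    α1 : α 1
    α1 = 0<M , path 0<M
    prevβM : ∀ {m} → m ≡ M → 0 < m → prev β m
    prevβM {suc m} refl _ = n≤1+n m , sym-A (path ≤-refl)
    fixed : ∀ {u} → u ≡ v 0 ⊎ u ≡ v M → ¬ OnOrHub cut? u × g u ≡ u
    fixed (inj₁ refl) = not , g0
      where
      not : ¬ OnOrHub cut? (v 0)
      not (inj₁ eq) = v≢h z≤n eq
      not (inj₂ cut) with subst Cut (pos-v z≤n) cut
      ... | inj₁ (_ , ¬α1) = ¬α1 α1
      ... | inj₂ (() , _)
      g0 : g (v 0) ≡ v 0
      g0 with α? (suc (pos (v 0)))
      ... | yes _ = refl
      ... | no ¬a = contradiction (subst (α ∘ suc) (sym (pos-v z≤n)) α1) ¬a
    fixed (inj₂ refl) = not , gM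
      where
      not : ¬ OnOrHub cut? (v M)
      not (inj₁ eq) = v≢h ≤-refl eq
      not (inj₂ cut) with subst Cut (pos-v ≤-refl) cut
      ... | inj₁ (¬β , _) = ¬β (prevβM refl 0<M)
      ... | inj₂ (_ , (M<M , _)) = <-irrefl refl M<M
      gM : g (v M) ≡ v M
      gM with α? (suc (pos (v M)))
      ... | no _ = refl
      ... | yes a = contradiction (subst (α ∘ suc) (pos-v ≤-refl) a) α-out
    t2≤S : t * 2 ≤ # (onOrHub? cut?)
    t2≤S = ≤-trans (*-monoʳ-≤ t 2≤R) (tough (onOrHub? cut?) R? g inv fixed 2≤R)

  -- The 2 pays for possible edges from the two ends to h.
  small-degree-sum : deg A (v 0) + deg A (v M) + t < 2 + n
  small-degree-sum = ≰⇒> λ 2+n≤ → closure-⊥ (cancel-≤ 2 (≤-trans 2+n≤ (+-monoˡ-≤ t (+-mono-≤ (bound 0) (bound M)))) refl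
      (lem (count α?) (count β?) t))
    where
    bound : ∀ m → deg A (v m) ≤ suc (count (adj? m))
    bound m = ≤-trans (deg≤ (v m)) (s≤s (count-mono (λ i → Adj? A (v m) (v i)) (adj? m) _,_))
    lem : ∀ a b t → suc a + suc b + t ≡ 2 + (a + b + t)
    lem = solve-∀

-- Removing an edge from a Hamiltonian cycle

module _ {n} {A : Graph (Fin n)} where

  walk? : ∀ u w l → Dec (Walk A u w l)
  walk? u w [] = no λ ()
  walk? u w (a ∷ []) with u Fin.≟ a | w Fin.≟ a
  ... | yes refl | yes refl = yes [ a ]
  ... | no u≢a   | _        = no λ { [ _ ] → u≢a refl }
  ... | _        | no w≢a   = no λ { [ _ ] → w≢a refl }
  walk? u w (a ∷ b ∷ l) with u Fin.≟ a | Adj? A u b | walk? b w (b ∷ l)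
  ... | yes refl | yes e | yes p = yes (e ∷ p)
  ... | no u≢a   | _     | _     = no λ { (_ ∷ _) → u≢a refl }
  ... | _        | no ¬e | _     = no λ { (e ∷ [ _ ]) → ¬e e ; (e ∷ (_ ∷ _)) → ¬e e }
  ... | _        | _     | no ¬p = no λ { (_ ∷ p@([ _ ])) → ¬p p ; (_ ∷ p@(_ ∷ _)) → ¬p p }

  first-∈ : ∀ {u w l} → Walk A u w l → u ∈ l
  first-∈ [ _ ]   = here refl
  first-∈ (_ ∷ _) = here refl

  last-∈ : ∀ {u w l} → Walk A u w l → w ∈ l
  last-∈ [ _ ]   = here refl
  last-∈ (_ ∷ p) = there (last-∈ p)

  closed-walk : ∀ {u l} → Walk A u u l → Unique l → length l ≡ 1
  closed-walk [ _ ]   _        = refl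
  closed-walk (_ ∷ p) (u∉ ∷ _) = contradiction refl (All.lookup u∉ (last-∈ p))

  positions : ∀ {u w l} → Walk A u w l → ∃ λ M → Σ (ℕ → Fin n) λ v →
    (∀ {i} → i < M → Adj A (v i) (v (suc i))) × map v (range 0 (suc M)) ≡ l × v 0 ≡ u × v M ≡ w
  positions [ u ] = 0 , (λ _ → u) , (λ ()) , refl , refl , refl
  positions {u} (e ∷ p) with M , v , path , eq , refl , refl ← positions p
    = suc M , v′ , path′ , cong (u ∷_) (trans (map-range v′ 0 (suc M)) eq) , refl , refl
    where
    v′ : ℕ → Fin n
    v′ zero    = u
    v′ (suc i) = v i
    path′ : ∀ {i} → i < suc M → Adj A (v′ i) (v′ (suc i))
    path′ {zero}  _         = e
    path′ {suc i} (s≤s i<M) = path i<M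

  hamPath : ∀ {h u w l} → Walk A u w l → h ∷ l ↭ allFin n →
            ∃ λ M → Σ (HamPath A h M) λ P → HamPath.v P 0 ≡ u × HamPath.v P M ≡ w
  hamPath p span with M , v , path , refl , eq₀ , eq₁ ← positions p
    = M , record { v = v ; path = path ; spanning = span } , eq₀ , eq₁

↭-allFin? : ∀ {n} (l : List (Fin n)) → Dec (l ↭ allFin n)
↭-allFin? {n} l with unique? l | Fin.all? (λ u → Any.any? (u Fin.≟_) l)
  where open UniqueDec (Fin.≡-decSetoid n)
... | no ¬u | _      = no λ p → ¬u (unique-↭ (↭-sym p) (Unique.allFin⁺ n))
... | _     | no ¬∈  = no λ p → ¬∈ λ u → Perm.∈-resp-↭ (↭-sym p) (∈-allFin u)
... | yes u | yes u∈ = yes (∼bag⇒↭ (unique∧set⇒bag u (Unique.allFin⁺ n) (mk⇔ (λ _ → ∈-allFin _) (λ _ → u∈ _))))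

searchList : ∀ {n} k {P : Pred (List (Fin n)) 0ℓ} → Decidable P → Dec (∃ λ l → length l ≡ k × P l)
searchList zero    P? with P? []
... | yes p = yes ([] , refl , p)
... | no ¬p = no λ { ([] , _ , p) → ¬p p }
searchList (suc k) P? with Fin.any? (λ u → searchList k (λ l → P? (u ∷ l)))
... | yes (u , l , eq , p) = yes (u ∷ l , cong suc eq , p)
... | no ¬p                = no λ { (u ∷ l , eq , p) → ¬p (u , l , suc-injective eq , p) }

-- Exhaustive search; the rotation arguments only refute the absence of a cycle, and decidability
-- turns that into a cycle.
hamCycle? : ∀ {n} (A : Graph (Fin n)) h → Dec (HamCycle A h)
hamCycle? {n} A h with searchList (n ∸ 1) (λ l →
  ↭-allFin? (h ∷ l) ×-dec Fin.any? λ u → Fin.any? λ w → walk? {A = A} u w l ×-dec Adj? A w u)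
... | yes (_ , _ , span , _ , _ , p , e) = yes (record { walk = p ; closing = e ; spanning = span })
... | no ¬ham = no λ C → let open HamCycle C in
  ¬ham (vertices , cong (_∸ 1) (trans (Perm.↭-length spanning) (List.length-tabulate {n = n} id)) , spanning , first , last , walk , closing)

unique-++⁻ : ∀ {A : Set} (l : List A) {m} → Unique (l ++ m) → Unique l × Unique m × (∀ {a} → a ∈ l → ¬ a ∈ m)
unique-++⁻ []      m!          = [] , m! , λ ()
unique-++⁻ (x ∷ l) (x∉ ∷ l++m!) with l! , m! , disjoint ← unique-++⁻ l l++m! =
  All.tabulate (λ a∈l → All.lookup x∉ (∈-++⁺ˡ a∈l)) ∷ l! , m! , λ where
    (here refl) a∈m → All.lookup x∉ (∈-++⁺ʳ l a∈m) refl
    (there a∈l) a∈m → disjoint a∈l a∈m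

module _ {n} (A : Graph (Fin n)) {x y : Fin n} (x≢y : x ≢ y) where

  NewEdge : Fin n → Fin n → Set
  NewEdge u w = (u ≡ x × w ≡ y) ⊎ (u ≡ y × w ≡ x)

  addEdge : Graph (Fin n)
  addEdge = record
    { Adj    = λ u w → Adj A u w ⊎ NewEdge u w
    ; sym    = λ { (inj₁ e) → inj₁ (Graph.sym A e) ; (inj₂ (inj₁ (p , q))) → inj₂ (inj₂ (q , p)) ; (inj₂ (inj₂ (p , q))) → inj₂ (inj₁ (q , p)) }
    ; irrefl = λ { refl (inj₁ e) → Graph.irrefl A refl e ; refl (inj₂ (inj₁ (refl , q))) → x≢y q ; refl (inj₂ (inj₂ (refl , q))) → x≢y (sym q) }
    ; Adj?   = λ u w → Adj? A u w ⊎-dec ((u Fin.≟ x ×-dec w Fin.≟ y) ⊎-dec (u Fin.≟ y ×-dec w Fin.≟ x)) }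

  private
    meets : ∀ {a b u w} {l : List (Fin n)} → NewEdge a b → NewEdge u w → a ∈ l → b ∈ l → u ∈ l
    meets (inj₁ (refl , refl)) (inj₁ (refl , _)) a∈ b∈ = a∈
    meets (inj₁ (refl , refl)) (inj₂ (refl , _)) a∈ b∈ = b∈
    meets (inj₂ (refl , refl)) (inj₁ (refl , _)) a∈ b∈ = b∈
    meets (inj₂ (refl , refl)) (inj₂ (refl , _)) a∈ b∈ = a∈

  oldWalk : ∀ {u w a b l} → NewEdge u w → All (u ≢_) l → Walk addEdge a b l → Walk A a b l
  oldWalk new u∉ [ a ] = [ a ]
  oldWalk new u∉ (inj₁ e ∷ p) = e ∷ oldWalk new (All.tail u∉) p
  oldWalk new u∉ (inj₂ e ∷ p) = contradiction refl (All.lookup u∉ (meets e new (here refl) (there (first-∈ p))))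

  data Split (u w : Fin n) : List (Fin n) → Set where
    splitWith : ∀ {p q l m} → Walk A u p l → NewEdge p q → Walk A q w m → Split u w (l ++ m)

  -- On traversing the new edge, a walk without repetitions leaves one of its ends for good, so it
  -- cannot traverse it again.
  splitWalk : ∀ {u w l} → Unique l → Walk addEdge u w l → Walk A u w l ⊎ Split u w l
  splitWalk _ [ u ] = inj₁ [ u ]
  splitWalk (u∉ ∷ _)  (inj₂ e ∷ p) = inj₂ (splitWith [ _ ] e (oldWalk e u∉ p))
  splitWalk (_ ∷ l!) (inj₁ e ∷ p) with splitWalk l! p
  ... | inj₁ q              = inj₁ (e ∷ q)
  ... | inj₂ (splitWith q f q′) = inj₂ (splitWith (e ∷ q) f q′)

  SpanningWalk : Fin n → Set
  SpanningWalk h = ∃ λ l → Walk A x y l × h ∷ l ↭ allFin n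

  private
    orient : ∀ {h u w l} → NewEdge u w → Walk A u w l → h ∷ l ↭ allFin n → SpanningWalk h
    orient (inj₁ (refl , refl)) p span = _ , p , span
    orient (inj₂ (refl , refl)) p span = _ , reverseʷ p , ↭-trans (prep _ (Perm.↭-reverse _)) span

    new-sym : ∀ {u w} → NewEdge u w → NewEdge w u
    new-sym (inj₁ (p , q)) = inj₂ (q , p)
    new-sym (inj₂ (p , q)) = inj₁ (q , p)

    same-ends : ∀ {a b u w} → NewEdge a b → NewEdge u w → u ≢ a → u ≡ b × w ≡ a
    same-ends (inj₁ (refl , refl)) (inj₁ (refl , refl)) u≢a = contradiction refl u≢a
    same-ends (inj₁ (refl , refl)) (inj₂ (refl , refl)) _   = refl , refl
    same-ends (inj₂ (refl , refl)) (inj₁ (refl , refl)) _   = refl , refl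
    same-ends (inj₂ (refl , refl)) (inj₂ (refl , refl)) u≢a = contradiction refl u≢a

  removeEdge : ∀ {h} → 4 ≤ n → HamCycle addEdge h → HamCycle A h ⊎ SpanningWalk h
  removeEdge {h} 4≤n C = go (splitWalk l! walk) closing spanning
    where
    open HamCycle C
    l! : Unique vertices
    l! with unique-↭ (↭-sym spanning) (Unique.allFin⁺ n)
    ... | _ ∷ u = u
    go : ∀ {l} → Walk A first last l ⊎ Split first last l → Adj A last first ⊎ NewEdge last first →
         h ∷ l ↭ allFin n → HamCycle A h ⊎ SpanningWalk h
    go (inj₁ p) (inj₁ e) span = inj₁ (record { walk = p ; closing = e ; spanning = span })
    go (inj₁ p) (inj₂ e) span = inj₂ (orient (new-sym e) p span)
    go (inj₂ (splitWith {l = l} {m} p f q)) (inj₁ e) span =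
      inj₂ (orient (new-sym f) (q ⟨ e ⟩ʷ p) (↭-trans (prep h (Perm.++-comm m l)) span))
    -- The new edge is used both inside the walk and to close it. Then both pieces are closed walks,
    -- hence single vertices, and n = 3.
    go (inj₂ (splitWith {l = l} {m} p f q)) (inj₂ e) span
      with _ ∷ lm! ← unique-↭ (↭-sym span) (Unique.allFin⁺ n)
      with l! , m! , disjoint ← unique-++⁻ l lm!
      with refl , refl ← same-ends f e (λ eq → disjoint (last-∈ p) (subst (_∈ m) eq (last-∈ q)))
      = contradiction
          (trans (sym (List.length-tabulate {n = n} id)) (trans (sym (Perm.↭-length span)) (cong suc (trans (List.length-++ l)
            (cong₂ _+_ (closed-walk p l!) (closed-walk q m!))))))
          (λ { refl → <⇒≱ (s≤s ≤-refl) 4≤n })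

  deg-addEdge : ∀ u → deg A u ≤ deg addEdge u
  deg-addEdge u = #-mono (Adj? A u) (Adj? addEdge u) inj₁

nonEdges : ∀ {n} → Graph (Fin n) → ℕ
nonEdges {n} A = ∑ (allFin n) λ u → # (λ w → ¬? (Adj? A u w))

nonEdges-addEdge : ∀ {n} (A : Graph (Fin n)) {x y} (x≢y : x ≢ y) → ¬ Adj A x y → nonEdges (addEdge A x≢y) < nonEdges A
nonEdges-addEdge {n} A {x} {y} x≢y x≁y = ∑-mono-< (allFin n) (λ u → ∑-mono (allFin n) λ {w} _ → fewer u w) (∈-allFin x)
  (∑-mono-< (allFin n) (λ w → fewer x w) (∈-allFin y)
    (subst₂ _<_ (sym (⟦⟧-no (¬? (Adj? (addEdge A x≢y) x y)) (λ ¬e → ¬e (inj₂ (inj₁ (refl , refl)))))) refl (⟦⟧-yes (¬? (Adj? A x y)) x≁y)))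
  where
  fewer : ∀ u w → ⟦ ¬? (Adj? (addEdge A x≢y) u w) ⟧ ≤ ⟦ ¬? (Adj? A u w) ⟧
  fewer u w = ⟦⟧-mono (¬? (Adj? (addEdge A x≢y) u w)) (¬? (Adj? A u w)) (λ ¬e e → ¬e (inj₁ e))

complete-hamCycle : ∀ {n} {A : Graph (Fin n)} h → 3 ≤ n → (∀ {u w} → u ≢ w → Adj A u w) → HamCycle A h
complete-hamCycle {n} {A} h 3≤n complete with xs , ys , eq ← ∈-∃++ (∈-allFin h) =
  go (xs ++ ys) span
  where
  span : h ∷ xs ++ ys ↭ allFin n
  span = ↭-trans (↭-sym (Perm.shift h xs ys)) (↭-reflexive (sym eq))
  walkAll : ∀ u l → Unique (u ∷ l) → ∃ λ w → Walk A u w (u ∷ l)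
  walkAll u []      _                = u , [ u ]
  walkAll u (w ∷ l) ((u≢w ∷ _) ∷ l!) with z , p ← walkAll w l l! = z , complete u≢w ∷ p
  size : ∀ {l} → h ∷ l ↭ allFin n → 3 ≤ suc (length l)
  size p = ≤-trans 3≤n (≤-reflexive (trans (sym (List.length-tabulate id)) (sym (Perm.↭-length p))))
  go : ∀ l → h ∷ l ↭ allFin n → HamCycle A h
  go []      p = contradiction (size p) λ { (s≤s ()) }
  go (u ∷ []) p = contradiction (size p) λ { (s≤s (s≤s ())) }
  go (u ∷ w ∷ l) p with _ ∷ (u∉ ∷ l!) ← unique-↭ (↭-sym p) (Unique.allFin⁺ n)
    with z , q ← walkAll w l l! = record
    { walk = complete (All.head u∉) ∷ q ; closing = complete (λ { refl → All.lookup u∉ (last-∈ q) refl }) ; spanning = p }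

-- Small degree sums

-- The bound on the degree at index n - j + t says that at least j + 1 - t vertices have degree at
-- least n - j. Adding edges weakens the hypothesis of this form and strengthens its conclusion, so
-- it is inherited; t stands on the right to avoid truncated subtraction.
DegreeCondition : ∀ {n} → ℕ → Graph (Fin n) → Set
DegreeCondition {n} t A = ∀ j → 1 ≤ j → 2 * j < n → j ≤ # (λ u → deg A u ≤? j) → suc j ≤ t + # (λ u → n ∸ j ≤? deg A u)

degreeCondition-⊆ : ∀ {n t} {G A : Graph (Fin n)} → (∀ u → deg G u ≤ deg A u) → DegreeCondition t G → DegreeCondition t A
degreeCondition-⊆ {n} {t} {G} {A} deg≤ cond j 1≤j 2j<n j≤ = ≤-trans
  (cond j 1≤j 2j<n (≤-trans j≤ (#-mono (λ u → deg A u ≤? j) (λ u → deg G u ≤? j) (λ {u} → ≤-trans (deg≤ u)))))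
  (+-monoʳ-≤ t (#-mono (λ u → n ∸ j ≤? deg G u) (λ u → n ∸ j ≤? deg A u) (λ {u} le → ≤-trans le (deg≤ u))))

halving : ∀ n → 1 ≤ n → ∃ λ j → 2 * j < n × n ≤ 2 * j + 2
halving 1 _ = 0 , s≤s z≤n , s≤s z≤n
halving 2 _ = 0 , s≤s z≤n , s≤s (s≤s z≤n)
halving (suc (suc n@(suc _))) _ with j , p , q ← halving n (s≤s z≤n) =
  suc j , subst (_< 2 + n) (sym (*-suc 2 j)) (s≤s (s≤s p)) , subst (λ k → 2 + n ≤ k + 2) (sym (*-suc 2 j)) (s≤s (s≤s q))

argmax : ∀ {n} {P : Pred (Fin n) 0ℓ} (P? : Decidable P) (f : Fin n → ℕ) → ∃ P → ∃ λ u → P u × (∀ w → P w → f w ≤ f u)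
argmax {n} {P} P? f (u₀ , p₀) with go (allFin n)
  where
  go : ∀ us → (∀ {w} → w ∈ us → ¬ P w) ⊎ ∃ λ u → P u × (∀ {w} → w ∈ us → P w → f w ≤ f u)
  go [] = inj₁ λ ()
  go (a ∷ us) with P? a | go us
  ... | no ¬a | inj₁ none = inj₁ λ { (here refl) → ¬a ; (there w∈) → none w∈ }
  ... | no ¬a | inj₂ (u , p , max) = inj₂ (u , p , λ { (here refl) a′ → contradiction a′ ¬a ; (there w∈) → max w∈ })
  ... | yes a′ | inj₁ none = inj₂ (a , a′ , λ { (here refl) _ → ≤-refl ; (there w∈) w′ → contradiction w′ (none w∈) })
  ... | yes a′ | inj₂ (u , p , max) with ≤-total (f a) (f u)
  ...   | inj₁ fa≤fu = inj₂ (u , p , λ { (here refl) _ → fa≤fu ; (there w∈) → max w∈ })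
  ...   | inj₂ fu≤fa = inj₂ (a , a′ , λ { (here refl) _ → ≤-refl ; (there w∈) w′ → ≤-trans (max w∈ w′) fu≤fa })
... | inj₁ none          = contradiction p₀ (none (∈-allFin u₀))
... | inj₂ (u , p , max) = u , p , λ w → max (∈-allFin w)

module _ {n} (A : Graph (Fin n)) where

  NonNeighbour : Fin n → Fin n → Set
  NonNeighbour u w = w ≢ u × ¬ Adj A u w

  nonNeighbour? : ∀ u → Decidable (NonNeighbour u)
  nonNeighbour? u w = ¬? (w Fin.≟ u) ×-dec ¬? (Adj? A u w)

  NonFull : Fin n → Set
  NonFull u = ∃ (NonNeighbour u)

  nonFull? : Decidable NonFull
  nonFull? u = Fin.any? (nonNeighbour? u)

  full-adj : ∀ {u w} → ¬ NonFull u → w ≢ u → Adj A u w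
  full-adj {u} {w} full w≢u = decidable-stable (Adj? A u w) λ ¬e → full (w , w≢u , ¬e)

  nonNeighbour-sym : ∀ {u w} → NonNeighbour u w → NonNeighbour w u
  nonNeighbour-sym (w≢u , ¬e) = (w≢u ∘ sym) , (¬e ∘ Graph.sym A)

  #nonNeighbours : ∀ u → n ≤ # (nonNeighbour? u) + 1 + deg A u
  #nonNeighbours u = begin
    n                                               ≡⟨ #-complement (Adj? A u) ⟨
    deg A u + # (λ w → ¬? (Adj? A u w))             ≤⟨ +-monoʳ-≤ (deg A u) (#-⊎ (nonNeighbour? u) (Fin._≟ u) (λ w → ¬? (Adj? A u w)) split) ⟩
    deg A u + (# (nonNeighbour? u) + # (λ w → w Fin.≟ u)) ≡⟨ cong (λ k → deg A u + (# (nonNeighbour? u) + k)) (#-≡ u) ⟩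
    deg A u + (# (nonNeighbour? u) + 1)             ≡⟨ +-comm (deg A u) _ ⟩
    # (nonNeighbour? u) + 1 + deg A u               ∎
    where
    open ≤-Reasoning
    split : ∀ {w} → ¬ Adj A u w → NonNeighbour u w ⊎ w ≡ u
    split {w} ¬e with w Fin.≟ u
    ... | yes eq = inj₂ eq
    ... | no ¬eq = inj₁ (¬eq , ¬e)

private
  arith-sparse : ∀ s f I i W → 2 ≤ s → (2 + s) * suc I ≤ f + I → f ≤ i → i + s ≤ W → W ≤ I + I → ⊥
  arith-sparse s f I i W 2≤s iso f≤i i+s≤W W≤ = case m≤n⇒∃[o]m+o≡n 2≤s of λ
    { (r , refl) → ≤⇒⊥ (r * I + I + 5 + 2 * r) (+-mono-≤ (+-mono-≤ iso f≤i) (+-mono-≤ i+s≤W W≤)) (lem r f I i W) }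
    where
    lem : ∀ r f I i W → (2 + (2 + r)) * suc I + f + (i + (2 + r) + W) ≡ suc (r * I + I + 5 + 2 * r) + (f + I + i + (W + (I + I)))
    lem = solve-∀

  arith-dense : ∀ t F n → 4 ≤ t → suc t * F ≤ n → n ≤ 2 * t + 2 * F → 5 * t ≤ n + 1 → ⊥
  arith-dense t F n 4≤t p q r = case m≤n⇒∃[o]m+o≡n 4≤t of λ
    { (k , refl) → ≤⇒⊥ (16 + 16 * k + 3 * (k * k))
      (+-mono-≤ (*-monoʳ-≤ 2 (≤-trans p q)) (*-monoʳ-≤ (3 + k) (≤-trans r (+-monoˡ-≤ 1 q)))) (lem k F) }
    where
    lem : ∀ k F → 2 * (suc (4 + k) * F) + (3 + k) * (5 * (4 + k))
      ≡ suc (16 + 16 * k + 3 * (k * k)) + (2 * (2 * (4 + k) + 2 * F) + (3 + k) * (2 * (4 + k) + 2 * F + 1))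
    lem = solve-∀

module LowDegreeSum
  {n t : ℕ} {A : Graph (Fin n)} (tough : ToughByLabels t A) (4≤t : 4 ≤ t) (cond : DegreeCondition t A)
  {x y : Fin n} (xy : NonNeighbour A y x)
  (y-max : ∀ u → NonFull A u → deg A u ≤ deg A y)
  (x-max : ∀ u → NonNeighbour A y u → deg A u ≤ deg A x)
  (low : deg A x + deg A y + t < 2 + n)
  where

  open ToughLemmas {t = t} {A = A} tough

  private
    sym-A = Graph.sym A
    i = deg A x
    dy = deg A y
    s = t ∸ 2

    t≡2+s : t ≡ 2 + s
    t≡2+s = sym (m+[n∸m]≡n (≤-trans (s≤s (s≤s z≤n)) 4≤t))

    2≤s : 2 ≤ s
    2≤s = ∸-monoˡ-≤ 2 4≤t

    low′ : i + dy + (2 + s) ≤ suc n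
    low′ = ≤-pred (subst (λ k → i + dy + k < 2 + n) t≡2+s low)

    full? : Decidable (λ u → ¬ NonFull A u)
    full? u = ¬? (nonFull? A u)

    f = # full?

    x-nonFull : NonFull A x
    x-nonFull = y , nonNeighbour-sym A xy

    y-nonFull : NonFull A y
    y-nonFull = x , xy

    W? = nonNeighbour? A y
    W = # W?

    i+s≤W : i + s ≤ W
    i+s≤W = cancel-≤ (n + 2 + dy) (+-mono-≤ low′ (#nonNeighbours A y)) (lem₁ i dy s n) (lem₂ n W dy)
      where
      lem₁ : ∀ i d s n → n + 2 + d + (i + s) ≡ i + d + (2 + s) + n
      lem₁ = solve-∀
      lem₂ : ∀ n w d → suc n + (w + 1 + d) ≡ n + 2 + d + w
      lem₂ = solve-∀

    i≤dy : i ≤ dy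
    i≤dy = y-max x x-nonFull

    full-nbr : ∀ {u w} → ¬ NonFull A u → NonFull A w → Adj A w u
    full-nbr fu nw = sym-A (full-adj A fu (λ { refl → fu nw }))

    f≤i : f ≤ i
    f≤i = #-mono full? (Adj? A x) (λ fu → full-nbr fu x-nonFull)

    2t≤i : t * 2 ≤ i
    2t≤i = 2t≤deg (proj₁ xy) (proj₂ xy ∘ sym-A)

    big-full : ∀ {k} → dy < k → # (λ u → k ≤? deg A u) ≤ f
    big-full {k} dy<k = #-mono (λ u → k ≤? deg A u) full? (λ {u} k≤ nf → <⇒≱ dy<k (≤-trans k≤ (y-max u nf)))

    W≤small : ∀ {j} → i ≤ j → W ≤ # (λ u → deg A u ≤? j)
    W≤small {j} i≤j = #-mono W? (λ u → deg A u ≤? j) (λ {u} w → ≤-trans (x-max u w) i≤j)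

  -- With i = deg x, the n − 1 − deg y non-neighbours of y have degree at most i, and the
  -- degree condition yields i − 1 full vertices: so they have at most one other neighbour each.
  sparse : 2 * (i + s) < n → ⊥
  sparse 2j<n = arith-sparse s f I i W 2≤s iso f≤i i+s≤W W≤2I
    where
    j = i + s
    dy<n∸j : dy < n ∸ j
    dy<n∸j = m+n≤o⇒m≤o∸n (suc dy) (cancel-≤ 1 low′ (lem i dy s) refl)
      where
      lem : ∀ i d s → 1 + (suc d + (i + s)) ≡ i + d + (2 + s)
      lem = solve-∀
    i≤1+f : i ≤ suc f
    i≤1+f = cancel-≤ (suc s) (≤-trans (cond j (≤-trans (s≤s z≤n) (≤-trans 2≤s (m≤n+m s i))) 2j<n (≤-trans i+s≤W (W≤small (m≤m+n i s))))
        (+-mono-≤ (≤-reflexive t≡2+s) (big-full dy<n∸j))) (cong suc (+-comm s i)) (cong suc (sym (+-suc s f)))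
    nonFull-W : ∀ {w} → NonNeighbour A y w → NonFull A w
    nonFull-W w = y , nonNeighbour-sym A w
    one-nbr : ∀ {w a b} → NonNeighbour A y w → NonFull A a → NonFull A b → Adj A w a → Adj A w b → a ≡ b
    one-nbr {w} {a} {b} w∈W na nb wa wb with a Fin.≟ b
    ... | yes eq = eq
    ... | no a≢b = contradiction (≤-trans many (≤-trans (x-max w w∈W) i≤1+f)) (<⇒≱ ≤-refl)
      where
      many : 2 + f ≤ deg A w
      many = begin
        2 + f                          ≡⟨ cong₂ _+_ (cong₂ _+_ (#-≡ a) (#-≡ b)) refl ⟨
        # (λ u → u Fin.≟ a) + # (λ u → u Fin.≟ b) + f ≤⟨ +-monoˡ-≤ f (#-disjoint (Fin._≟ a) (Fin._≟ b) ab? (λ (p , q) → a≢b (trans (sym p) q)) (λ p → p)) ⟩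
        # ab? + f                      ≤⟨ #-disjoint ab? full? (Adj? A w)
                                            (λ { (inj₁ refl , fu) → fu na ; (inj₂ refl , fu) → fu nb })
                                            (λ { (inj₁ (inj₁ refl)) → wa ; (inj₁ (inj₂ refl)) → wb ; (inj₂ fu) → full-nbr fu (nonFull-W w∈W) }) ⟩
        deg A w                        ∎
        where
        open ≤-Reasoning
        ab? : Decidable (λ u → u ≡ a ⊎ u ≡ b)
        ab? u = u Fin.≟ a ⊎-dec u Fin.≟ b
    Smaller : Fin n → Fin n → Set
    Smaller w u = NonNeighbour A y u × Adj A w u × u Fin.< w
    smaller? : ∀ w u → Dec (Smaller w u)
    smaller? w u = W? u ×-dec Adj? A w u ×-dec u Fin.<? w
    Ind Dep : Pred (Fin n) 0ℓ
    Ind w = NonNeighbour A y w × ¬ ∃ (Smaller w)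
    Dep w = NonNeighbour A y w × ∃ (Smaller w)
    ind? : Decidable Ind
    ind? w = W? w ×-dec ¬? (Fin.any? (smaller? w))
    dep? : Decidable Dep
    dep? w = W? w ×-dec Fin.any? (smaller? w)
    I = # ind?
    dep≤ind : # dep? ≤ I
    dep≤ind = #-injection dep? ind? {E = λ w u → NonNeighbour A y w × Smaller w u} (λ w u → W? w ×-dec smaller? w u)
      (λ {w} (w∈W , u , sm@(u∈W , wu , u<w)) → u , (u∈W , λ (z , z∈W , uz , z<u) →
          <-asym u<w (subst (Fin._< u) (one-nbr u∈W (nonFull-W z∈W) (nonFull-W w∈W) uz (sym-A wu)) z<u)) , w∈W , sm)
      (λ (w∈W , u∈W , wu , _) (w′∈W , _ , w′u , _) → one-nbr u∈W (nonFull-W w∈W) (nonFull-W w′∈W) (sym-A wu) (sym-A w′u))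
    W≤2I : W ≤ I + I
    W≤2I = ≤-trans (#-⊎ ind? dep? W? split) (+-monoʳ-≤ I dep≤ind)
      where
      split : ∀ {w} → NonNeighbour A y w → Ind w ⊎ Dep w
      split {w} w∈W with Fin.any? (smaller? w)
      ... | yes p = inj₂ (w∈W , p)
      ... | no ¬p = inj₁ (w∈W , ¬p)
    Reached Cut : Pred (Fin n) 0ℓ
    Reached w = NonFull A w × ∃ λ u → Ind u × Adj A u w
    Cut w = ¬ NonFull A w ⊎ Reached w
    reached? : Decidable Reached
    reached? w = nonFull? A w ×-dec Fin.any? (λ u → ind? u ×-dec Adj? A u w)
    cut? : Decidable Cut
    cut? w = full? w ⊎-dec reached? w
    reached≤ind : # reached? ≤ I
    reached≤ind = #-injection reached? ind? {E = λ w u → NonFull A w × Ind u × Adj A u w}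
      (λ w u → nonFull? A w ×-dec ind? u ×-dec Adj? A u w)
      (λ (nw , u , iu , e) → u , iu , nw , iu , e)
      (λ (nw , (u∈W , _) , e) (nw′ , _ , e′) → one-nbr u∈W nw nw′ e e′)
    independent : ∀ {u w} → Ind u → Ind w → ¬ Adj A u w
    independent {u} {w} (u∈W , ¬u) (w∈W , ¬w) e with Fin.<-cmp u w
    ... | tri< u<w _ _  = ¬w (u , u∈W , sym-A e , u<w)
    ... | tri≈ _ refl _ = Graph.irrefl A refl e
    ... | tri> _ _ w<u  = ¬u (w , w∈W , e , w<u)
    1≤I : 1 ≤ I
    1≤I = case I ≟ 0 of λ where
      (yes eq) → contradiction (≤-trans 2≤s (≤-trans (m≤n+m s i) (≤-trans i+s≤W (subst (λ k → W ≤ k + k) eq W≤2I)))) λ ()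
      (no ≢0)  → n≢0⇒n>0 ≢0
    iso : (2 + s) * suc I ≤ f + I
    iso = subst (λ k → k * suc I ≤ f + I) t≡2+s (≤-trans
      (isolated ind? cut? {y} (λ ((y≢y , _) , _) → y≢y refl)
        (λ { (inj₁ fy) → fy y-nonFull ; (inj₂ (_ , u , ((_ , ¬yu) , _) , uy)) → ¬yu (sym-A uy) })
        (λ { (u∈W , _) (inj₁ fu) → fu (nonFull-W u∈W) ; iu (inj₂ (_ , u′ , iu′ , e)) → independent iu′ iu e })
        (λ {u} {w} iu e → case nonFull? A w of λ where
          (yes nw) → inj₂ (nw , u , iu , e)
          (no fw)  → inj₁ fw)
        1≤I)
      (≤-trans (#-⊎ full? reached? cut? (λ p → p)) (+-monoʳ-≤ f reached≤ind)))

  -- About half of the vertices are full, and on a Hamiltonian path from x to y their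
  -- predecessors, together with y, are independent.
  dense : n ≤ 2 * (i + s) → ∀ {h M} (P : HamPath A h M) → HamPath.v P 0 ≡ x → HamPath.v P M ≡ y → HamCycle A h
  dense n≤ {h} {M} P refl refl = decidable-stable (hamCycle? A h) λ ¬ham → impossible ¬ham
    where
    open HamPath P
    open Rotations P
    open Count M
    open Positions P
    FP : Pred ℕ 0ℓ
    FP k = k ≤ M × ¬ NonFull A (v k)
    fp? : Decidable FP
    fp? k = k ≤? M ×-dec full? (v k)
    I? = on? (fp? ∘ suc)
    I = # I?
    f≤ : f ≤ suc I
    f≤ = begin
      f                                                ≡⟨ ∑-positions (⟦_⟧ ∘ full?) ⟩
      ⟦ full? h ⟧ + ∑ (range 0 (suc M)) (⟦_⟧ ∘ full? ∘ v) ≤⟨ +-mono-≤ (⟦⟧≤1 (full? h)) (count-mono (full? ∘ v) fp? _,_) ⟩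
      suc (count fp?)                                  ≤⟨ s≤s (count-unsuc fp? (λ (_ , fx) → fx x-nonFull)) ⟩
      suc (count (fp? ∘ suc))                          ≤⟨ s≤s (count≤#on (fp? ∘ suc)) ⟩
      suc I                                            ∎
      where open ≤-Reasoning
    5t≤ : 5 * t ≤ n + 1
    5t≤ = cancel-≤ (i + dy) (+-mono-≤ (+-mono-≤ 2t≤i (≤-trans 2t≤i i≤dy)) (≤-pred low)) (lem t i dy) (lem₂ i dy n)
      where
      lem : ∀ t i d → i + d + 5 * t ≡ t * 2 + t * 2 + (i + d + t)
      lem = solve-∀
      lem₂ : ∀ i d n → i + d + suc n ≡ i + d + (n + 1)
      lem₂ = solve-∀
    n≤2t+2f : n ≤ 2 * t + 2 * f
    n≤2t+2f with j , 2j<n , n≤2j+2 ← halving n (≤-trans (s≤s z≤n) (≤-trans (≤-trans (≤-trans 4≤t (m≤m*n t 2)) 2t≤i) (#≤n (Adj? A x)))) = begin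
      n                ≤⟨ n≤2j+2 ⟩
      2 * j + 2        ≡⟨ trans (+-comm (2 * j) 2) (sym (*-suc 2 j)) ⟩
      2 * suc j        ≤⟨ *-monoʳ-≤ 2 (≤-trans (cond j 1≤j 2j<n (≤-trans j≤i+s (≤-trans i+s≤W (W≤small i≤j)))) (+-monoʳ-≤ t (big-full dy<))) ⟩
      2 * (t + f)      ≡⟨ *-distribˡ-+ 2 t f ⟩
      2 * t + 2 * f    ∎
      where
      open ≤-Reasoning
      i≤j : i ≤ j
      i≤j = ≮⇒≥ λ j<i → ≤⇒⊥ s (+-mono-≤ (+-mono-≤ (*-monoʳ-≤ 2 j<i) i≤dy) (+-mono-≤ low′ n≤2j+2)) (lem i dy s n j)
        where
        lem : ∀ i d s n j → 2 * suc j + i + (i + d + (2 + s) + n) ≡ suc s + (2 * i + d + (suc n + (2 * j + 2)))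
        lem = solve-∀
      1≤j : 1 ≤ j
      1≤j = ≤-trans (≤-trans (s≤s z≤n) (≤-trans 4≤t (≤-trans (m≤m*n t 2) 2t≤i))) i≤j
      j≤i+s : j ≤ i + s
      j≤i+s = *-cancelˡ-≤ 2 (≤-trans (<⇒≤ 2j<n) n≤)
      dy< : dy < n ∸ j
      dy< = m+n≤o⇒m≤o∸n (suc dy) (*-cancelˡ-≤ 2 (cancel-≤ (2 + 2 * (i + s) + n)
          (+-mono-≤ (+-mono-≤ (*-monoʳ-≤ 2 low′) (<⇒≤ 2j<n)) n≤) (lem i dy s j n) (lem₂ i s n)))
        where
        lem : ∀ i d s j n → 2 + 2 * (i + s) + n + 2 * (suc d + j) ≡ 2 * (i + d + (2 + s)) + 2 * j + n
        lem = solve-∀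
        lem₂ : ∀ i s n → 2 * suc n + n + 2 * (i + s) ≡ 2 + 2 * (i + s) + n + 2 * n
        lem₂ = solve-∀
    arith : suc t * suc I ≤ n → ⊥
    arith p = arith-dense t (suc I) n 4≤t p (≤-trans n≤2t+2f (+-monoʳ-≤ (2 * t) (*-monoʳ-≤ 2 f≤))) 5t≤
    1≤I : 1 ≤ I
    1≤I = ≮⇒≥ λ I<1 → ≤⇒⊥ 8
      (+-mono-≤ (+-mono-≤ (+-mono-≤ 5t≤ n≤2t+2f) (+-mono-≤ (*-monoʳ-≤ 2 f≤) (*-monoʳ-≤ 2 I<1))) (*-monoʳ-≤ 3 4≤t)) (lem t n f I)
      where
      lem : ∀ t n f I → 5 * t + n + (2 * f + 2 * suc I) + 3 * 4 ≡ suc 8 + (n + 1 + (2 * t + 2 * f) + (2 * suc I + 2 * 1) + 3 * t)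
      lem = solve-∀
    y∉I : ¬ On (fp? ∘ suc) y
    y∉I (_ , N≤M , _) = <-irrefl refl (subst (_< M) (pos-v ≤-refl) N≤M)
    impossible : ¬ HamCycle A h → ⊥
    impossible ¬ham = arith (begin
      suc t * suc I                  ≡⟨ +-comm (suc I) (t * suc I) ⟩
      t * suc I + suc I              ≤⟨ +-monoˡ-≤ (suc I) (isolated I? S? {y} y∉I (λ (_ , y≢y) → y≢y refl) (λ iu (¬iu , _) → ¬iu iu) nbrs 1≤I) ⟩
      # S? + suc I                   ≡⟨ trans (+-suc (# S?) I) (trans (cong suc (+-comm (# S?) I)) (cong₂ _+_ (sym (#-≡ y)) refl)) ⟩
      # (Fin._≟ y) + (I + # S?)      ≤⟨ +-monoʳ-≤ (# (Fin._≟ y)) (#-disjoint I? S? ¬y? (λ (iu , ¬iu , _) → ¬iu iu) (λ { (inj₁ iu) refl → y∉I iu ; (inj₂ (_ , u≢y)) → u≢y })) ⟩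
      # (Fin._≟ y) + # ¬y?           ≡⟨ #-complement (Fin._≟ y) ⟩
      n                              ∎)
      where
      open ≤-Reasoning
      ¬y? : Decidable (_≢ y)
      ¬y? u = ¬? (u Fin.≟ y)
      S? : Decidable (λ u → ¬ On (fp? ∘ suc) u × u ≢ y)
      S? u = ¬? (I? u) ×-dec ¬? (u Fin.≟ y)
      x~full : ∀ {k} → FP k → x~ k
      x~full (_ , fk) = full-nbr fk x-nonFull
      y~full : ∀ {k} → FP k → y~ k
      y~full (_ , fk) = full-nbr fk y-nonFull
      nbrs : ∀ {u w} → On (fp? ∘ suc) u → Adj A u w → ¬ On (fp? ∘ suc) w × w ≢ y
      nbrs {u} {w} (u≢h , a@(a<M , _)) e = notOn , λ { refl → ¬ham (crossing a<M (x~full a)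
          (sym-A (subst (λ u → Adj A u y) (sym (proj₂ (pos-spec u≢h))) e))) }
        where
        notOn : ¬ On (fp? ∘ suc) w
        notOn (w≢h , b@(b<M , _)) with e′ ← subst₂ (Adj A) (sym (proj₂ (pos-spec u≢h))) (sym (proj₂ (pos-spec w≢h))) e | <-cmp (pos u) (pos w)
        ... | tri< a<b _ _ = ¬ham (chord-right a<b b<M e′ (x~full b) (y~full a))
        ... | tri≈ _ eq _  = Graph.irrefl A (cong v eq) e′
        ... | tri> _ _ b<a = ¬ham (chord-right b<a a<M (sym-A e′) (x~full a) (y~full b))

-- Hamiltonian cycles and pancyclicity

module _ {n t : ℕ} (4≤t : 4 ≤ t) (3≤n : 3 ≤ n) (h : Fin n) where

  private
    closePath : ∀ {A : Graph (Fin n)} → ToughByLabels t A → DegreeCondition t A → ∀ {x y} → NonNeighbour A y x →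
      (∀ u → NonFull A u → deg A u ≤ deg A y) → (∀ u → NonNeighbour A y u → deg A u ≤ deg A x) →
      (∃ λ M → Σ (HamPath A h M) λ P → HamPath.v P 0 ≡ x × HamPath.v P M ≡ y) → HamCycle A h
    closePath {A} tough cond {x} {y} xy y-max x-max (M , P , eq₀ , eq₁)
      with deg A x + deg A y + t <? 2 + n | 2 * (deg A x + (t ∸ 2)) <? n
    ... | yes low | yes few = ⊥-elim (LowDegreeSum.sparse {t = t} {A = A} tough 4≤t cond xy y-max x-max low few)
    ... | yes low | no many = LowDegreeSum.dense {t = t} {A = A} tough 4≤t cond xy y-max x-max low (≮⇒≥ many) P eq₀ eq₁
    ... | no high | _       = decidable-stable (hamCycle? A h) λ ¬ham → high (subst₂ (λ x y → deg A x + deg A y + t < 2 + n) eq₀ eq₁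
      (Closure.small-degree-sum {t = t} P tough 4≤t ¬ham
        (n≢0⇒n>0 λ { refl → proj₁ xy (trans (sym eq₀) eq₁) })))

  hamCycle : ∀ fuel {A : Graph (Fin n)} → nonEdges A < fuel → ToughByLabels t A → DegreeCondition t A → HamCycle A h
  hamCycle (suc fuel) {A} (s≤s e≤) tough cond with Fin.any? (nonFull? A)
  ... | no ¬nf = complete-hamCycle h 3≤n (λ {u} u≢w → full-adj A (λ nf → ¬nf (u , nf)) (u≢w ∘ sym))
  ... | yes nf with y , nfy , y-max ← argmax (nonFull? A) (deg A) nf
    with x , xy , x-max ← argmax (nonNeighbour? A y) (deg A) nfy
    with removeEdge A (proj₁ xy) 4≤n (hamCycle fuel {addEdge A (proj₁ xy)}
      (≤-trans (nonEdges-addEdge A (proj₁ xy) (proj₂ xy ∘ Graph.sym A)) e≤)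
      (toughByLabels-⊆ {t = t} {G = A} {A = addEdge A (proj₁ xy)} inj₁ tough)
      (degreeCondition-⊆ {t = t} {G = A} {A = addEdge A (proj₁ xy)} (deg-addEdge A (proj₁ xy)) cond))
    where
    4≤n : 4 ≤ n
    4≤n = ≤-trans 4≤t (≤-trans (m≤m*n t 2) (≤-trans (ToughLemmas.2t≤deg {t = t} {A = A} tough (proj₁ xy) (proj₂ xy ∘ Graph.sym A)) (#≤n (Adj? A x))))
  ...   | inj₁ C              = C
  ...   | inj₂ (_ , p , span) = closePath tough cond xy y-max x-max (hamPath p span)

private
  1≤half : ∀ {n j} → 3 ≤ n → n ≤ 2 * j + 2 → 1 ≤ j
  1≤half {n} {j} 3≤n n≤ = ≮⇒≥ λ j<1 → ≤⇒⊥ 0 (+-mono-≤ (≤-trans 3≤n n≤) (*-monoʳ-≤ 2 j<1)) (lem j)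
    where
    lem : ∀ j → 3 + 2 * suc j ≡ 1 + (2 * j + 2 + 2 * 1)
    lem = solve-∀

large-degree : ∀ {n t} {G : Graph (Fin n)} → 1 ≤ t → 3 ≤ n → ToughByLabels t G → DegreeCondition t G → ∃ λ h → n ≤ 2 * deg G h
large-degree {n} {t} {G} 1≤t 3≤n tough cond with j , 2j<n , n≤2j+2 ← halving n (≤-trans (s≤s z≤n) 3≤n)
  | j ≤? # (λ u → deg G u ≤? j)
... | no few = h , (begin
  n                ≤⟨ n≤2j+2 ⟩
  2 * j + 2        ≡⟨ trans (+-comm (2 * j) 2) (sym (*-suc 2 j)) ⟩
  2 * suc j        ≤⟨ *-monoʳ-≤ 2 (≰⇒> large) ⟩
  2 * deg G h      ∎)
  where
  open ≤-Reasoning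
  low? : Decidable (λ u → deg G u ≤ j)
  low? u = deg G u ≤? j
  some : ∃ λ u → ¬ deg G u ≤ j
  some = #-positive (λ u → ¬? (low? u)) (≮⇒≥ λ none → ≤⇒⊥ (suc j) (+-mono-≤ (≰⇒> few)
    (+-mono-≤ 2j<n (+-mono-≤ (≤-reflexive (sym (#-complement low?))) none))) (lem (# low?) j n (# (λ u → ¬? (low? u)))))
    where
    lem : ∀ l j n c → suc l + (suc (2 * j) + (n + suc c)) ≡ suc (suc j) + (j + (n + (l + c + 1)))
    lem = solve-∀
  h = proj₁ some
  large = proj₂ some
... | yes many with u , small ← #-positive (λ u → deg G u ≤? j) (≤-trans (1≤half 3≤n n≤2j+2) many) = h , ≮⇒≥ λ 2d<n → ≤⇒⊥ 1
    (+-mono-≤ (+-mono-≤ 2j<n 2d<n) (*-monoʳ-≤ 2 (≤-trans (m≤n+m∸n n j) (+-monoʳ-≤ j large)))) (lem j (deg G h) n)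
  where
  1≤j : 1 ≤ j
  1≤j = 1≤half 3≤n n≤2j+2
  lem : ∀ j d n → suc (2 * j) + suc (2 * d) + 2 * n ≡ suc 1 + (n + n + 2 * (j + d))
  lem = solve-∀
  other : ∃ (NonNeighbour G u)
  other = #-positive (nonNeighbour? G u) (≮⇒≥ λ none → ≤⇒⊥ 0
    (+-mono-≤ (+-mono-≤ (#nonNeighbours G u) small) (+-mono-≤ (+-mono-≤ 2j<n none) 1≤j)) (lem₂ n (deg G u) j (# (nonNeighbour? G u))))
    where
    lem₂ : ∀ n d j c → n + d + (suc (2 * j) + suc c + 1) ≡ 1 + (c + 1 + d + j + (n + 1 + j))
    lem₂ = solve-∀
  t2≤j : t * 2 ≤ j
  t2≤j = ≤-trans (ToughLemmas.2t≤deg {t = t} {A = G} tough (proj₁ (proj₂ other) ∘ sym) (proj₂ (proj₂ other))) small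
  some : ∃ λ u → n ∸ j ≤ deg G u
  some = #-positive (λ u → n ∸ j ≤? deg G u) (≮⇒≥ λ none → ≤⇒⊥ 1
    (+-mono-≤ (+-mono-≤ none (cond j 1≤j 2j<n many)) (+-mono-≤ t2≤j 1≤t)) (lem₃ (# (λ u → n ∸ j ≤? deg G u)) j t))
    where
    lem₃ : ∀ c j t → suc c + suc j + (t * 2 + 1) ≡ suc 1 + (1 + (t + c) + (j + t))
    lem₃ = solve-∀
  h = proj₁ some
  large = proj₂ some

degreeCondition : ∀ {n t} {G : Graph (Fin n)} {d : Fin n → ℕ} → IsDegreeSequence G d →
  (∀ (i j : Fin n) → 2 * index i < n → index j ≡ (n ∸ index i) + t → d i ≤ index i → n ∸ index i ≤ d j) →
  DegreeCondition t G
degreeCondition {n} {t} {G} {d} (mono , π , deg≡d) hyp j@(suc j′) 1≤j 2j<n j≤ with t ≤? j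
... | no t≰j  = ≤-trans (≰⇒> t≰j) (m≤m+n t _)
... | yes t≤j = cancel-≤ m (≤-trans (≤-reflexive n≡) (≤-trans n≤ (+-monoʳ-≤ k tail≤))) (+-comm m (suc j)) (+-assoc m t _)
  where
  deg≡ : ∀ i → deg G (π ⟨$⟩ʳ i) ≡ d i
  deg≡ i = trans (sym (degree≡deg G (π ⟨$⟩ʳ i))) (deg≡d i)
  below? : ∀ c → Decidable (λ (i : Fin n) → toℕ i < c)
  below? c i = toℕ i <? c
  #below : ∀ c → # (below? c) ≤ c
  #below c = ≤-trans (#-injection (below? c) {λ _ → ⊤} (λ _ → yes tt) {E = λ i k → toℕ i ≡ toℕ k} (λ i k → toℕ i ≟ toℕ k)
    (λ i<c → Fin.fromℕ< i<c , tt , sym (Fin.toℕ-fromℕ< i<c)) (λ p q → Fin.toℕ-injective (trans p (sym q)))) (#≤n {c} (λ _ → yes tt))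
  j≤n : j ≤ n
  j≤n = ≤-trans (m≤n*m j 2) (<⇒≤ 2j<n)
  i₀ : Fin n
  i₀ = Fin.fromℕ< j≤n
  index-i₀ : index i₀ ≡ j
  index-i₀ = cong suc (Fin.toℕ-fromℕ< j≤n)
  d-i₀ : d i₀ ≤ j
  d-i₀ = ≮⇒≥ λ j<d → <⇒≱ ≤-refl (≤-trans j≤ (≤-trans
    (#-injection (λ u → deg G u ≤? j) (below? j′) {E = λ u i → π ⟨$⟩ʳ i ≡ u} (λ u i → π ⟨$⟩ʳ i Fin.≟ u)
      (λ {u} du≤j → π ⟨$⟩ˡ u
        , ≰⇒> (λ j′≤ → <⇒≱ j<d (≤-trans (mono (subst (_≤ toℕ (π ⟨$⟩ˡ u)) (sym (suc-injective index-i₀)) j′≤))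
                (≤-trans (≤-reflexive (trans (sym (deg≡ _)) (cong (deg G) (inverseʳ π)))) du≤j)))
        , inverseʳ π)
      (λ p q → trans (sym p) q))
    (#below j′)))
  j<n : j < n
  j<n = ≤-trans (s≤s (m≤n*m j 2)) 2j<n
  m = proj₁ (m≤n⇒∃[o]m+o≡n j<n)
  n≡ : suc j + m ≡ n
  n≡ = proj₂ (m≤n⇒∃[o]m+o≡n j<n)
  n∸j≡ : n ∸ j ≡ suc m
  n∸j≡ = trans (cong (_∸ j) (trans (sym n≡) (sym (+-suc j m)))) (m+n∸m≡n j (suc m))
  k = m + t
  k<n : k < n
  k<n = subst (k <_) n≡ (≤-trans (s≤s (+-monoʳ-≤ m t≤j)) (≤-reflexive (cong suc (+-comm m j))))
  j₀ : Fin n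
  j₀ = Fin.fromℕ< k<n
  n∸j≤d : n ∸ j ≤ d j₀
  n∸j≤d = subst (λ a → n ∸ a ≤ d j₀) index-i₀ (hyp i₀ j₀
    (subst (λ a → 2 * a < n) (sym index-i₀) 2j<n)
    (trans (cong suc (Fin.toℕ-fromℕ< k<n)) (cong (_+ t) (trans (sym n∸j≡) (cong (n ∸_) (sym index-i₀)))))
    (subst (d i₀ ≤_) (sym index-i₀) d-i₀))
  tail? : Decidable (λ i → ¬ toℕ i < k)
  tail? i = ¬? (below? k i)
  n≤ : n ≤ k + # tail?
  n≤ = ≤-trans (≤-reflexive (sym (#-complement (below? k)))) (+-monoˡ-≤ (# tail?) (#below k))
  tail≤ : # tail? ≤ # (λ u → n ∸ j ≤? deg G u)
  tail≤ = #-injection tail? (λ u → n ∸ j ≤? deg G u) {E = λ i u → π ⟨$⟩ʳ i ≡ u} (λ i u → π ⟨$⟩ʳ i Fin.≟ u)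
    (λ {i} k≤i → π ⟨$⟩ʳ i
      , ≤-trans n∸j≤d (≤-trans (mono (subst (_≤ toℕ i) (sym (Fin.toℕ-fromℕ< k<n)) (≮⇒≥ k≤i))) (≤-reflexive (sym (deg≡ i))))
      , refl)
    (λ p q → trans (sym (inverseˡ π)) (trans (cong (π ⟨$⟩ˡ_) (trans p (sym q))) (inverseˡ π)))

module _ {n} {G : Graph (Fin n)} {h : Fin n} {M : ℕ} (P : HamPath G h M) (closing : Adj G (HamPath.v P M) (HamPath.v P 0)) where

  open HamPath P
  open Positions P

  private
    N = suc M

    next : ℕ → ℕ
    next k with k <? M
    ... | yes _ = suc k
    ... | no _  = 0

    next≤M : ∀ k → next k ≤ M
    next≤M k with k <? M
    ... | yes k<M = k<M
    ... | no _    = z≤n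

    next-injective : ∀ {k l} → k ≤ M → l ≤ M → next k ≡ next l → k ≡ l
    next-injective {k} {l} k≤M l≤M eq with k <? M | l <? M
    next-injective k≤M l≤M refl | yes _ | yes _ = refl
    next-injective k≤M l≤M eq   | no p  | no q  = trans (≤-antisym k≤M (≮⇒≥ p)) (≤-antisym (≮⇒≥ q) l≤M)

    adj-next : ∀ {k} → k ≤ M → Adj G (v k) (v (next k))
    adj-next {k} k≤M with k <? M
    ... | yes k<M = path k<M
    ... | no ¬k<M with refl ← ≤-antisym k≤M (≮⇒≥ ¬k<M) = closing

    -- i modulo N, defined so that one step along the cycle is one application of next.
    ρ : ℕ → ℕ
    ρ zero    = 0
    ρ (suc i) = next (ρ i)

    ρ≤M : ∀ i → ρ i ≤ M
    ρ≤M zero    = z≤n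
    ρ≤M (suc i) = next≤M (ρ i)

    ρ-small : ∀ {i} → i ≤ M → ρ i ≡ i
    ρ-small {zero}  _   = refl
    ρ-small {suc i} i<M rewrite ρ-small (<⇒≤ i<M) with i <? M
    ... | yes _ = refl
    ... | no ¬p = contradiction i<M ¬p

    ρ-period : ∀ i → ρ (i + N) ≡ ρ i
    ρ-period zero    rewrite ρ-small {M} ≤-refl with M <? M
    ... | yes M<M = contradiction M<M (<-irrefl refl)
    ... | no _    = refl
    ρ-period (suc i) = cong next (ρ-period i)

    ρ-window : ∀ i {a b} → a ≤ M → b ≤ M → ρ (i + a) ≡ ρ (i + b) → a ≡ b
    ρ-window zero    a≤M b≤M eq = trans (sym (ρ-small a≤M)) (trans eq (ρ-small b≤M))
    ρ-window (suc i) {a} {b} a≤M b≤M eq = ρ-window i a≤M b≤M (next-injective (ρ≤M (i + a)) (ρ≤M (i + b)) eq)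

    c : ℕ → Fin n
    c i = v (ρ i)

    f : ℕ → ℕ
    f i = ⟦ Adj? G h (c i) ⟧

    f-period : ∀ i → f (i + N) ≡ f i
    f-period i = cong (λ k → ⟦ Adj? G h (v k) ⟧) (ρ-period i)

    ∑-rotate : ∀ r → ∑ (range 0 N) (λ i → f (r + i)) ≡ ∑ (range 0 N) f
    ∑-rotate zero    = refl
    ∑-rotate (suc r) = trans (∑-cong (range 0 N) (λ {i} _ → cong f (sym (+-suc r i)))) (trans
      (+-cancelˡ-≡ (g 0) _ _ (begin
        g 0 + ∑ (range 0 N) (g ∘ suc)  ≡⟨ cong (g 0 +_) (∑-range-suc 0 N g) ⟨
        ∑ (range 0 (suc N)) g          ≡⟨ ∑-range-last N g ⟩
        ∑ (range 0 N) g + g N          ≡⟨ cong (∑ (range 0 N) g +_) (trans (f-period r) (cong f (sym (+-identityʳ r)))) ⟩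
        ∑ (range 0 N) g + g 0          ≡⟨ +-comm (∑ (range 0 N) g) (g 0) ⟩
        g 0 + ∑ (range 0 N) g          ∎))
      (∑-rotate r))
      where
      open ≡-Reasoning
      g : ℕ → ℕ
      g i = f (r + i)

    deg-h : deg G h ≡ ∑ (range 0 N) f
    deg-h = trans (∑-positions (⟦_⟧ ∘ Adj? G h)) (cong₂ _+_ (⟦⟧-no (Adj? G h h) (Graph.irrefl G refl))
      (∑-cong (range 0 N) (λ {i} i∈ → cong (λ k → ⟦ Adj? G h (v k) ⟧) (sym (ρ-small (≤-pred (proj₂ (∈-range⁻ i∈))))))))

    chord : ∀ r → n ≤ 2 * deg G h → ∃ λ i → Adj G h (c i) × Adj G h (c (r + i))
    chord r n≤2d = proj₁ found , ⟦⟧-sound (both? (proj₁ found)) (proj₂ (proj₂ found))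
      where
      both? : ∀ i → Dec (Adj G h (c i) × Adj G h (c (r + i)))
      both? i = Adj? G h (c i) ×-dec Adj? G h (c (r + i))
      pointwise : ∀ i → f i + f (r + i) ≤ 1 + ⟦ both? i ⟧
      pointwise i with Adj? G h (c i) | Adj? G h (c (r + i))
      ... | yes _ | yes _ = ≤-refl
      ... | yes _ | no _  = ≤-refl
      ... | no _  | yes _ = ≤-refl
      ... | no _  | no _  = z≤n
      2d≤ : 2 * deg G h ≤ N + ∑ (range 0 N) (λ i → ⟦ both? i ⟧)
      2d≤ = begin
        2 * deg G h                                        ≡⟨ cong (deg G h +_) (+-identityʳ (deg G h)) ⟩
        deg G h + deg G h                                  ≡⟨ cong₂ _+_ deg-h (trans deg-h (sym (∑-rotate r))) ⟩
        ∑ (range 0 N) f + ∑ (range 0 N) (λ i → f (r + i))  ≡⟨ ∑-+ (range 0 N) f (λ i → f (r + i)) ⟨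
        ∑ (range 0 N) (λ i → f i + f (r + i))              ≤⟨ ∑-mono (range 0 N) (λ {i} _ → pointwise i) ⟩
        ∑ (range 0 N) (λ i → 1 + ⟦ both? i ⟧)              ≡⟨ ∑-+ (range 0 N) (λ _ → 1) (λ i → ⟦ both? i ⟧) ⟩
        ∑ (range 0 N) (λ _ → 1) + ∑ (range 0 N) (λ i → ⟦ both? i ⟧) ≡⟨ cong (_+ ∑ (range 0 N) (λ i → ⟦ both? i ⟧)) (∑-ones 0 N) ⟩
        N + ∑ (range 0 N) (λ i → ⟦ both? i ⟧)              ∎
        where open ≤-Reasoning
      positive : 1 ≤ ∑ (range 0 N) (λ i → ⟦ both? i ⟧)
      positive = cancel-≤ N (≤-trans n≤2d 2d≤) (trans (+-comm N 1) (sym n≡2+M)) refl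
      found = ∑-positive (range 0 N) (λ i → ⟦ both? i ⟧) positive

  -- A chord of span r at h cuts out a cycle of length r + 2.
  pancyclic : n ≤ 2 * deg G h → Pancyclic G
  pancyclic n≤2d (suc (suc r)) 3≤ℓ@(s≤s (s≤s _)) ℓ≤n with i , hi , hj ← chord r n≤2d = record
    { 3≤ℓ = 3≤ℓ ; vertex = vertex ; injective = injective ; step = step ; close = close }
    where
    r≤M : r ≤ M
    r≤M = ≤-pred (≤-pred (subst (2 + r ≤_) n≡2+M ℓ≤n))
    bound : ∀ (k : Fin (suc r)) → toℕ k ≤ M
    bound k = ≤-trans (≤-pred (Fin.toℕ<n k)) r≤M
    vertex : Fin (suc (suc r)) → Fin n
    vertex Fin.zero    = h
    vertex (Fin.suc k) = c (i + toℕ k)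
    injective : ∀ {k l} → vertex k ≡ vertex l → k ≡ l
    injective {Fin.zero}  {Fin.zero}  _  = refl
    injective {Fin.zero}  {Fin.suc l} eq = contradiction (sym eq) (v≢h (ρ≤M (i + toℕ l)))
    injective {Fin.suc k} {Fin.zero}  eq = contradiction eq (v≢h (ρ≤M (i + toℕ k)))
    injective {Fin.suc k} {Fin.suc l} eq = cong Fin.suc (Fin.toℕ-injective
      (ρ-window i (bound k) (bound l) (v-injective (ρ≤M (i + toℕ k)) (ρ≤M (i + toℕ l)) eq)))
    step : ∀ k l → toℕ l ≡ suc (toℕ k) → Adj G (vertex k) (vertex l)
    step Fin.zero    (Fin.suc l) eq rewrite suc-injective eq | +-identityʳ i = hi
    step (Fin.suc k) (Fin.suc l) eq rewrite suc-injective eq | +-suc i (toℕ k) = adj-next (ρ≤M (i + toℕ k))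
    close : ∀ k l → toℕ k ≡ 0 → suc (toℕ l) ≡ suc (suc r) → Adj G (vertex l) (vertex k)
    close Fin.zero (Fin.suc l) _ eq rewrite suc-injective (suc-injective eq) | +-comm i r = Graph.sym G hj

corollary4 : ∀ (t : ℕ) → 4 ≤ t →
    ∀ (n : ℕ) → 3 ≤ n →
    ∀ (G : Graph (Fin n)) → Tough t G →
    ∀ (d : Fin n → ℕ) → IsDegreeSequence G d →
    (∀ (i j : Fin n) → 2 * index i < n → index j ≡ (n ∸ index i) + t →
    d i ≤ index i → n ∸ index i ≤ d j) →
    Pancyclic G
corollary4 t 4≤t n 3≤n G tough d isDeg hyp
  with tough′ ← toughByLabels {t = t} {G = G} tough | cond ← degreeCondition {t = t} {G = G} isDeg hyp
  with h , n≤2d ← large-degree {t = t} {G = G} (≤-trans (s≤s z≤n) 4≤t) 3≤n tough′ cond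
  with C ← hamCycle 4≤t 3≤n h (suc (nonEdges G)) {G} ≤-refl tough′ cond
  with M , P , eq₀ , eq₁ ← hamPath (HamCycle.walk C) (HamCycle.spanning C)
  = pancyclic P (subst₂ (Adj G) (sym eq₁) (sym eq₀) (HamCycle.closing C)) n≤2d
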